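{- Let $\mathbb{F}$ be any field and let $k \leq n$ be positive integers. Let $J_{n,k} \subseteq \mathbb{F}[x_1,\dots,x_n]$ be the ideal $$J_{n,k} = \langle h_k(x_1), h_k(x_1,x_2), \dots, h_k(x_1,\dots,x_n), e_n(x_1,\dots,x_n), e_{n-1}(x_1,\dots,x_n), \dots, e_{n-k+1}(x_1,\dots,x_n)\rangle$$ and let $S_{n,k} = \mathbb{F}[x_1,\dots,x_n]/J_{n,k}$, graded by polynomial degree. Then $$\mathrm{Hilb}(S_{n,k};q) := \sum_{d\ge 0} \dim_{\mathbb{F}}\big((S_{n,k})_d\big)\, q^d = \mathrm{rev}_q\big([k]!_q \cdot \mathrm{Stir}_q(n,k)\big).$$ In particular $\dim_{\mathbb{F}} S_{n,k} = k!\cdot \mathrm{Stir}(n,k)$, the number of ordered set partitions of $\{1,\dots,n\}$ into $k$ blocks.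
   Context: $h_d(x_1,\dots,x_i) = \sum_{1\le j_1\le \cdots\le j_d\le i} x_{j_1}\cdots x_{j_d}$ is the complete homogeneous symmetric polynomial and $e_d(x_1,\dots,x_n)$ the elementary symmetric polynomial of degree $d$. $J_{n,k}$ is homogeneous, so $S_{n,k}$ is graded. $[m]_q = 1+q+\cdots+q^{m-1}$, $[k]!_q = [k]_q[k-1]_q\cdots[1]_q$. The $q$-Stirling numbers are defined by $\mathrm{Stir}_q(0,k)=\delta_{0,k}$ and $\mathrm{Stir}_q(n,k) = \mathrm{Stir}_q(n-1,k-1) + [k]_q\,\mathrm{Stir}_q(n-1,k)$. For a polynomial $f(q)$, $\mathrm{rev}_q(f)$ is the polynomial obtained by reversing its coefficient sequence, i.e. $\mathrm{rev}_q(f)(q) = q^{\deg f} f(1/q)$ (e.g. $\mathrm{rev}_q(3q^3+2q^2+1)=q^3+2q+3$). $\mathrm{Stir}(n,k)$ is the Stirling number of the second kind. -}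

module Defs where

open import Level using (Level; _⊔_) renaming (suc to lsuc)
open import Algebra.Bundles using (CommutativeRing)
open import Data.Nat as ℕ using (ℕ; zero; suc; _∸_; _!)
open import Data.Nat.Properties using () renaming (_≟_ to _≟ℕ_)
open import Data.Fin using (Fin)
open import Data.Vec as V using (Vec; []; _∷_)
open import Data.Vec.Properties using (≡-dec)
open import Data.List as L using (List; []; _∷_; _++_; map; concatMap; upTo)
open import Data.Product using (Σ; _×_; _,_; ∃)
open import Relation.Binary.PropositionalEquality using (_≡_)
open import Relation.Nullary using (¬_; yes; no)

record Field (c ℓ : Level) : Set (lsuc (c ⊔ ℓ)) where
  field
    commutativeRing : CommutativeRing c ℓ
  open CommutativeRing commutativeRing public
  field
    1≉0     : ¬ (1# ≈ 0#)
    inverse : ∀ x → ¬ (x ≈ 0#) → Σ Carrier λ y → x * y ≈ 1#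

module Poly {c ℓ : Level} (F : Field c ℓ) where
  open Field F using (Carrier; _≈_; _+_; _*_; -_; 0#; 1#)

  Mon : ℕ → Set
  Mon n = Vec ℕ n

  Pol : ℕ → Set c
  Pol n = List (Carrier × Mon n)

  coeff : ∀ {n} → Pol n → Mon n → Carrier
  coeff []              α = 0#
  coeff ((a , β) ∷ p)   α with ≡-dec _≟ℕ_ β α
  ... | yes _ = a + coeff p α
  ... | no  _ = coeff p α

  _≐_ : ∀ {n} → Pol n → Pol n → Set ℓ
  p ≐ q = ∀ α → coeff p α ≈ coeff q α

  0P : ∀ {n} → Pol n
  0P = []

  _+P_ : ∀ {n} → Pol n → Pol n → Pol n
  p +P q = p ++ q

  _·P_ : ∀ {n} → Carrier → Pol n → Pol n
  a ·P p = map (λ { (b , β) → (a * b , β) }) p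

  -P_ : ∀ {n} → Pol n → Pol n
  -P p = (- 1#) ·P p

  _*P_ : ∀ {n} → Pol n → Pol n → Pol n
  p *P q = concatMap (λ { (a , α) → map (λ { (b , β) → (a * b , V.zipWith ℕ._+_ α β) }) q }) p

  sumP : ∀ {n} → List (Pol n) → Pol n
  sumP = L.foldr _+P_ 0P

  deg : ∀ {n} → Mon n → ℕ
  deg = V.sum

  Homogeneous : ∀ {n} → ℕ → Pol n → Set ℓ
  Homogeneous d p = ∀ α → ¬ (deg α ≡ d) → coeff p α ≈ 0#

  prefixMons : (n i d : ℕ) → List (Mon n)
  prefixMons zero    i       zero    = [] ∷ []
  prefixMons zero    i       (suc d) = []
  prefixMons (suc n) zero    d       = map (0 ∷_) (prefixMons n zero d)
  prefixMons (suc n) (suc i) d       =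
    concatMap (λ a → map (a ∷_) (prefixMons n i (d ∸ a))) (upTo (suc d))

  squarefreeMons : (n j : ℕ) → List (Mon n)
  squarefreeMons zero    zero    = [] ∷ []
  squarefreeMons zero    (suc j) = []
  squarefreeMons (suc n) zero    = map (0 ∷_) (squarefreeMons n zero)
  squarefreeMons (suc n) (suc j) =
    map (0 ∷_) (squarefreeMons n (suc j)) ++ map (1 ∷_) (squarefreeMons n j)

  sumOfMons : ∀ {n} → List (Mon n) → Pol n
  sumOfMons = map (λ α → (1# , α))

  h : (n d i : ℕ) → Pol n
  h n d i = sumOfMons (prefixMons n i d)

  e : (n j : ℕ) → Pol n
  e n j = sumOfMons (squarefreeMons n j)

  gensJ : (n k : ℕ) → List (Pol n)
  gensJ n k = map (λ i → h n k (suc i)) (upTo n)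
           ++ map (λ t → e n (n ∸ t)) (upTo k)

  InIdeal : ∀ {n} → List (Pol n) → Pol n → Set (c ⊔ ℓ)
  InIdeal {n} gs p =
    Σ (Vec (Pol n) (L.length gs)) λ cs →
      p ≐ sumP (V.toList (V.zipWith _*P_ cs (V.fromList gs)))

  linComb : ∀ {n m} → (Fin m → Carrier) → (Fin m → Pol n) → Pol n
  linComb {m = m} a b = sumP (V.toList (V.tabulate {n = m} (λ i → a i ·P b i)))

  -- The F-subspace of F[x]/I spanned by the images of the polynomials
  -- satisfying P (P closed under F-linear combinations) has a basis of
  -- size m: there are m polynomials b₁,…,b_m satisfying P whose images
  -- span that subspace modulo I and are linearly independent modulo I.
  HasDimMod : ∀ {n} → List (Pol n) → (Pol n → Set ℓ) → ℕ → Set (c ⊔ ℓ)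
  HasDimMod {n} I P m =
    Σ (Fin m → Pol n) λ b →
      (∀ i → P (b i))
      × (∀ p → P p → Σ (Fin m → Carrier) λ a → InIdeal I (p +P (-P linComb a b)))
      × (∀ a → InIdeal I (linComb a b) → ∀ i → a i ≈ 0#)

  dimGradedS≡ : (n k d m : ℕ) → Set (c ⊔ ℓ)
  dimGradedS≡ n k d m = HasDimMod (gensJ n k) (Homogeneous d) m

  dimS≡ : (n k m : ℕ) → Set (c ⊔ ℓ)
  dimS≡ n k m = HasDimMod (gensJ n k) (λ _ → Level.Lift ℓ Data.Unit.⊤) m
    where import Data.Unit

-- Polynomials in q with ℕ coefficients: coefficient lists, lowest degree
-- first (trailing zeros allowed).

QPol : Set
QPol = List ℕ

_+q_ : QPol → QPol → QPol
[]       +q g        = g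
f        +q []       = f
(a ∷ f)  +q (b ∷ g)  = (a ℕ.+ b) ∷ (f +q g)

_*q_ : QPol → QPol → QPol
[]      *q g = []
(a ∷ f) *q g = map (a ℕ.*_) g +q (0 ∷ (f *q g))

qInt : ℕ → QPol
qInt m = L.replicate m 1

qFact : ℕ → QPol
qFact zero    = 1 ∷ []
qFact (suc k) = qInt (suc k) *q qFact k

-- Stir_q(0,k) = δ_{0,k},  Stir_q(n,k) = Stir_q(n-1,k-1) + [k]_q Stir_q(n-1,k)
-- (with Stir_q(n-1,-1) = 0)
qStir : ℕ → ℕ → QPol
qStir zero    zero    = 1 ∷ []
qStir zero    (suc k) = []
qStir (suc n) zero    = qInt 0 *q qStir n 0
qStir (suc n) (suc k) = qStir n k +q (qInt (suc k) *q qStir n (suc k))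

stir : ℕ → ℕ → ℕ
stir zero    zero    = 1
stir zero    (suc k) = 0
stir (suc n) zero    = 0
stir (suc n) (suc k) = stir n k ℕ.+ suc k ℕ.* stir n (suc k)

dropLeadingZeros : List ℕ → List ℕ
dropLeadingZeros []            = []
dropLeadingZeros (zero ∷ xs)   = dropLeadingZeros xs
dropLeadingZeros (suc x ∷ xs)  = suc x ∷ xs

-- rev_q f = q^{deg f} f(1/q): reverse the coefficient sequence
-- (from the true leading coefficient down to the constant term)
revq : QPol → QPol
revq f = dropLeadingZeros (L.reverse f)

coeffq : QPol → ℕ → ℕ
coeffq []       d       = 0
coeffq (a ∷ f)  zero    = a
coeffq (a ∷ f)  (suc d) = coeffq f d

-- The monomials x^a with a admissible span S_{n,k} and are linearly independent
-- in it, over any commutative ring.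
--
-- Spanning. Fix k and let I(N,s) be generated by the h_k(x₁,…,x_i), i ≤ N, and
-- the e_m(x₁,…,x_N), m > N − s, so that J_{n,k} = I(n,k). Filtering by powers of
-- x₁, the j-th layer is a quotient of the polynomials in x₂,…,x_N by I(N−1,s−1)
-- if j < s, by I(N−1,s) if s ≤ j < k, and vanishes if j ≥ k.
--
-- Independence. A permutation w whose Lehmer code a is admissible gives the
-- functional f ↦ (∂_w f)(0), with ∂_w the divided difference operator. As ∂_i is
-- linear over polynomials symmetric in x_i, x_{i+1}, these functionals vanish on
-- J_{n,k}, and their matrix on the admissible monomials is unitriangular for the
-- lexicographic order.
--
-- Counting. With s and r = k − s as parameters, the codegree generating functions
-- satisfy G(N,r,s) = [s] G(N−1,r+1,s−1) + [r] G(N−1,r,s), whence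
-- G(N,r+1,s) = G(N,r,s) + q^r G(N,r,s+1) and so G(n,0,k) = [k]!_q Stir_q(n,k).
module Submission where

open import Defs
open import Level using (Level; _⊔_; lift)
open import Algebra.Bundles using (CommutativeRing; AbelianGroup)
open import Data.Bool using (true; false)
open import Data.Empty using (⊥; ⊥-elim)
open import Data.Fin as Fin using (Fin)
open import Data.List as L using (List; []; _∷_; _++_; map; concatMap; upTo)
import Data.List.Properties as L
open import Data.List.Membership.Propositional using (_∈_)
open import Data.List.Membership.Propositional.Properties
  using (∈-++⁺ˡ; ∈-++⁺ʳ; ∈-map⁺; ∈-upTo⁺; ∈-lookup; ∈-filter⁺)
open import Data.List.Relation.Unary.All as All using ([]; _∷_) renaming (All to AllL)
import Data.List.Relation.Unary.All.Properties as All
open import Data.List.Relation.Unary.AllPairs using (AllPairs; []; _∷_)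
import Data.List.Relation.Unary.AllPairs.Properties as AllPairs
open import Data.List.Relation.Unary.Any using (here; there)
open import Data.Nat as ℕ using (ℕ; zero; suc; _≤_; _<_; z≤n; s≤s; _!)
import Data.Nat.Properties as ℕ
open import Data.Nat.Solver using (module +-*-Solver)
open import Data.Product using (Σ; _×_; _,_; proj₁; proj₂)
open import Data.Sum using (_⊎_; inj₁; inj₂)
open import Data.Unit using (⊤; tt)
open import Data.Vec as V using (Vec; []; _∷_)
import Data.Vec.Properties as V
open import Data.Vec.Properties using (≡-dec)
open import Data.Vec.Relation.Unary.All using ([]; _∷_) renaming (All to VAll)
open import Function using (_⟨_⟩_)
open import Relation.Nullary using (yes; no; contradiction)
open import Relation.Binary.PropositionalEquality as ≡ using (_≡_; _≢_; _≗_; module ≡-Reasoning)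
import Algebra.Construct.Pointwise as Pointwise
import Algebra.Properties.AbelianGroup as AbelianGroupProperties
import Algebra.Solver.CommutativeMonoid as CMSolver
import Relation.Binary.Reasoning.Setoid as SetoidReasoning

-- An admissible word need not be the Lehmer code of a permutation of the n variables: its last
-- entry can be as large as k - 1. The permutations therefore act on n + k variables, and `restrict`
-- looks only at polynomials that do not involve the last k of them. No single generator
-- h_k(x₁,...,x_i) with i < n is symmetric in all the variables that ∂_w moves, so ∂_w cannot be
-- carried past it as a whole. What is propagated instead, one entry of the code at a time, is
-- vanishing on e_m or h_m in an initial segment of variables. The length of the segment and the
-- range of m change with the entry, and the two cases of `Admissible` are the two ways in which the
-- segment for e_m can change. Polynomials are lists of terms that may repeat or cancel, compared by
-- coefficients. Both halves of the proof replace this by equality under every linear functional,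
-- which is additive in the list. Degrees are counted from the top because there the two kinds of
-- first exponent share their maximum; this is why the recurrence for G carries no power of q.

-- The standard monomials of S_{n,k} are those admissible for r = 0, s = k: each
-- exponent is < r + s, and an exponent < s moves one unit from s to r.
Admissible : ∀ {N} → ℕ → ℕ → Vec ℕ N → Set
Admissible r s       []       = s ≡ 0
Admissible r zero    (a ∷ as) = a < r × Admissible r zero as
Admissible r (suc s) (a ∷ as) =
  (a < suc s × Admissible (suc r) s as) ⊎ ((suc s ≤ a × a < suc s ℕ.+ r) × Admissible r (suc s) as)

-- Both moves preserve r + s, so the bound is the same at every position.
Admissible⇒< : ∀ {N} r s (as : Vec ℕ N) → Admissible r s as → VAll (_< s ℕ.+ r) as
Admissible⇒< r s       []       _                         = []
Admissible⇒< r zero    (a ∷ as) (a<r , adm)               = a<r ∷ Admissible⇒< r zero as adm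
Admissible⇒< r (suc s) (a ∷ as) (inj₁ (a<1+s , adm))      =
  ℕ.≤-trans a<1+s (ℕ.m≤m+n (suc s) r) ∷
  ≡.subst (λ k → VAll (_< k) as) (ℕ.+-suc s r) (Admissible⇒< (suc r) s as adm)
Admissible⇒< r (suc s) (a ∷ as) (inj₂ ((_ , a<k) , adm)) = a<k ∷ Admissible⇒< r (suc s) as adm

infix 4 _<ₗ_
_<ₗ_ : ∀ {N} → Vec ℕ N → Vec ℕ N → Set
[]       <ₗ []       = ⊥
(a ∷ as) <ₗ (b ∷ bs) = a < b ⊎ (a ≡ b × as <ₗ bs)

-- Divided differences acting on linear functionals

module DividedDifferences {c ℓ : Level} (R : CommutativeRing c ℓ) where
  open CommutativeRing R hiding (zero)
  open AbelianGroupProperties +-abelianGroup using () renaming (∙-cancelʳ to +-cancelʳ)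

  -- D₂ g a b is g applied to the divided difference (f − s f)/(x − y) of
  -- f = xᵃ yᵇ; the clauses are ∂(x f) = f + y ∂f and ∂(y f) = − f + x ∂f.
  D₂ : (ℕ → ℕ → Carrier) → ℕ → ℕ → Carrier
  D₂ g zero    zero    = 0#
  D₂ g zero    (suc b) = - g zero b + D₂ (λ p q → g (suc p) q) zero b
  D₂ g (suc a) b       = g a b + D₂ (λ p q → g p (suc q)) a b

  D₂-cong : ∀ {g h} → (∀ p q → g p q ≈ h p q) → ∀ a b → D₂ g a b ≈ D₂ h a b
  D₂-cong g≈h zero    zero    = refl
  D₂-cong g≈h zero    (suc b) = +-cong (-‿cong (g≈h zero b)) (D₂-cong (λ p q → g≈h (suc p) q) zero b)
  D₂-cong g≈h (suc a) b       = +-cong (g≈h a b) (D₂-cong (λ p q → g≈h p (suc q)) a b)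

  open CMSolver +-commutativeMonoid using (solve; _⊕_; _⊜_)

  interchange : ∀ w x y z → (w + x) + (y + z) ≈ (w + y) + (x + z)
  interchange = solve 4 (λ w x y z → (w ⊕ x) ⊕ (y ⊕ z) ⊜ (w ⊕ y) ⊕ (x ⊕ z)) refl

  D₂-+ : ∀ g h a b → D₂ (λ p q → g p q + h p q) a b ≈ D₂ g a b + D₂ h a b
  D₂-+ g h zero    zero    = sym (+-identityˡ 0#)
  D₂-+ g h zero    (suc b) = trans
    (+-cong (sym (⁻¹-∙-comm (g zero b) (h zero b))) (D₂-+ (λ p q → g (suc p) q) (λ p q → h (suc p) q) zero b))
    (interchange _ _ _ _)
    where open AbelianGroupProperties +-abelianGroup using (⁻¹-∙-comm)
  D₂-+ g h (suc a) b       = trans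
    (+-congˡ (D₂-+ (λ p q → g p (suc q)) (λ p q → h p (suc q)) a b))
    (interchange _ _ _ _)

  D₂-0 : ∀ a b → D₂ (λ _ _ → 0#) a b ≈ 0#
  D₂-0 zero    zero    = refl
  D₂-0 zero    (suc b) = trans (+-cong ε⁻¹≈ε (D₂-0 zero b)) (+-identityˡ 0#)
    where open AbelianGroupProperties +-abelianGroup using (ε⁻¹≈ε)
  D₂-0 (suc a) b       = trans (+-congˡ (D₂-0 a b)) (+-identityˡ 0#)

  -- The rule ∂(y f) + f = x ∂f, which `D₂` has as a clause only when x does not occur in f.
  D₂-suc : ∀ g a b → D₂ g a (suc b) + g a b ≈ D₂ (λ p q → g (suc p) q) a b
  D₂-suc g zero b = trans
    (solve 3 (λ x y z → (x ⊕ y) ⊕ z ⊜ (x ⊕ z) ⊕ y) refl _ _ _)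
    (trans (+-congʳ (-‿inverseˡ (g zero b))) (+-identityˡ _))
  D₂-suc g (suc a) b = trans
    (solve 3 (λ x y z → (x ⊕ y) ⊕ z ⊜ z ⊕ (y ⊕ x)) refl _ _ _)
    (+-congˡ (D₂-suc (λ p q → g p (suc q)) a b))

  -- ∂ is linear over symmetric polynomials in x and y. The generators x + y and x y, here and in
  -- `D₂-product`, suffice for all e_m and h_m.
  D₂-sum : ∀ g a b → D₂ (λ p q → g (suc p) q + g p (suc q)) a b ≈ D₂ g (suc a) b + D₂ g a (suc b)
  D₂-sum g a b = trans
    (D₂-+ (λ p q → g (suc p) q) (λ p q → g p (suc q)) a b)
    (trans (+-congʳ (sym (D₂-suc g a b)))
           (solve 3 (λ x y z → (x ⊕ y) ⊕ z ⊜ (y ⊕ z) ⊕ x) refl _ _ _))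

  D₂-product : ∀ g a b → D₂ (λ p q → g (suc p) (suc q)) a b ≈ D₂ g (suc a) (suc b)
  D₂-product g a b = trans (sym (D₂-suc (λ p q → g p (suc q)) a b)) (+-comm _ _)

  -- Linear functionals on R[x₀,…,x_{L-1}], given by their values on monomials.
  Func : ℕ → Set c
  Func L = Vec ℕ L → Carrier

  Funcs : ℕ → AbelianGroup c ℓ
  Funcs L = record
    { isAbelianGroup = Pointwise.isAbelianGroup (Vec ℕ L) +-isAbelianGroup }

  infix 4 _≋_
  _≋_ : ∀ {L} → Func L → Func L → Set ℓ
  _≋_ {L} = AbelianGroup._≈_ (Funcs L)

  infixl 6 _⊹_
  _⊹_ : ∀ {L} → Func L → Func L → Func L
  _⊹_ {L} = AbelianGroup._∙_ (Funcs L)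

  𝟘 : ∀ {L} → Func L
  𝟘 _ = 0#

  ≋-refl : ∀ {L} {φ : Func L} → φ ≋ φ
  ≋-refl _ = refl

  ≋-sym : ∀ {L} {φ ψ : Func L} → φ ≋ ψ → ψ ≋ φ
  ≋-sym p α = sym (p α)

  ≋-trans : ∀ {L} {φ ψ χ : Func L} → φ ≋ ψ → ψ ≋ χ → φ ≋ χ
  ≋-trans p q α = trans (p α) (q α)

  ⊹-cong : ∀ {L} {φ φ′ ψ ψ′ : Func L} → φ ≋ φ′ → ψ ≋ ψ′ → φ ⊹ ψ ≋ φ′ ⊹ ψ′
  ⊹-cong p q α = +-cong (p α) (q α)

  record Additive {L : ℕ} (T : Func L → Func L) : Set (c ⊔ ℓ) where
    field
      cong  : ∀ {φ ψ} → φ ≋ ψ → T φ ≋ T ψ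
      homo  : ∀ φ ψ → T (φ ⊹ ψ) ≋ T φ ⊹ T ψ

    zero-homo : T 𝟘 ≋ 𝟘
    zero-homo α = +-identityʳ-unique _ _
      (trans (sym (homo 𝟘 𝟘 α)) (cong (λ _ → +-identityˡ 0#) α))
      where open AbelianGroupProperties +-abelianGroup
              using () renaming (identityʳ-unique to +-identityʳ-unique)

    kills : ∀ {φ} → φ ≋ 𝟘 → T φ ≋ 𝟘
    kills φ≋𝟘 = ≋-trans (cong φ≋𝟘) zero-homo

  open Additive

  -- τ j is dual to multiplication by x_j, and D j to the divided difference in
  -- x_j, x_{j+1}. Both are 0 when the index is out of range.
  τ : ∀ {L} → ℕ → Func L → Func L
  τ j       φ []      = 0#
  τ zero    φ (a ∷ α) = φ (suc a ∷ α)
  τ (suc j) φ (a ∷ α) = τ j (λ β → φ (a ∷ β)) α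

  D : ∀ {L} → ℕ → Func L → Func L
  D j       φ []          = 0#
  D zero    φ (a ∷ [])    = 0#
  D zero    φ (a ∷ b ∷ α) = D₂ (λ p q → φ (p ∷ q ∷ α)) a b
  D (suc j) φ (a ∷ α)     = D j (λ β → φ (a ∷ β)) α

  τ-additive : ∀ {L} j → Additive {L} (τ j)
  τ-additive j = record { cong = λ p α → τ-cong j p α ; homo = τ-homo j }
    where
    τ-cong : ∀ {L} j {φ ψ : Func L} → φ ≋ ψ → τ j φ ≋ τ j ψ
    τ-cong j       p []      = refl
    τ-cong zero    p (a ∷ α) = p (suc a ∷ α)
    τ-cong (suc j) p (a ∷ α) = τ-cong j (λ β → p (a ∷ β)) α
    τ-homo : ∀ {L} j (φ ψ : Func L) → τ j (φ ⊹ ψ) ≋ τ j φ ⊹ τ j ψ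
    τ-homo j       φ ψ []      = sym (+-identityˡ 0#)
    τ-homo zero    φ ψ (a ∷ α) = refl
    τ-homo (suc j) φ ψ (a ∷ α) = τ-homo j (λ β → φ (a ∷ β)) (λ β → ψ (a ∷ β)) α

  D-additive : ∀ {L} j → Additive {L} (D j)
  D-additive j = record { cong = λ p α → D-cong j p α ; homo = D-homo j }
    where
    D-cong : ∀ {L} j {φ ψ : Func L} → φ ≋ ψ → D j φ ≋ D j ψ
    D-cong j       p []          = refl
    D-cong zero    p (a ∷ [])    = refl
    D-cong zero    p (a ∷ b ∷ α) = D₂-cong (λ x y → p (x ∷ y ∷ α)) a b
    D-cong (suc j) p (a ∷ α)     = D-cong j (λ β → p (a ∷ β)) α
    D-homo : ∀ {L} j (φ ψ : Func L) → D j (φ ⊹ ψ) ≋ D j φ ⊹ D j ψ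
    D-homo j       φ ψ []          = sym (+-identityˡ 0#)
    D-homo zero    φ ψ (a ∷ [])    = sym (+-identityˡ 0#)
    D-homo zero    φ ψ (a ∷ b ∷ α) = D₂-+ (λ x y → φ (x ∷ y ∷ α)) (λ x y → ψ (x ∷ y ∷ α)) a b
    D-homo (suc j) φ ψ (a ∷ α)     = D-homo j (λ β → φ (a ∷ β)) (λ β → ψ (a ∷ β)) α

  τ-comm : ∀ {L} i j (φ : Func L) → τ i (τ j φ) ≋ τ j (τ i φ)
  τ-comm i       j       φ []      = refl
  τ-comm zero    zero    φ (a ∷ α) = refl
  τ-comm zero    (suc j) φ (a ∷ α) = refl
  τ-comm (suc i) zero    φ (a ∷ α) = refl
  τ-comm (suc i) (suc j) φ (a ∷ α) = τ-comm i j (λ β → φ (a ∷ β)) α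

  τ-D₂ : ∀ {L} i (G : ℕ → ℕ → Func L) a b α →
         D₂ (λ p q → τ i (G p q) α) a b ≈ τ i (λ β → D₂ (λ p q → G p q β) a b) α
  τ-D₂ i       G a b []      = D₂-0 a b
  τ-D₂ zero    G a b (x ∷ α) = refl
  τ-D₂ (suc i) G a b (x ∷ α) = τ-D₂ i (λ p q β → G p q (x ∷ β)) a b α

  D-τ-comm : ∀ {L} j i → i ≢ j → i ≢ suc j → (φ : Func L) → D j (τ i φ) ≋ τ i (D j φ)
  D-τ-comm j       i             i≢j i≢1+j φ []          = refl
  D-τ-comm zero    zero          i≢j i≢1+j φ (a ∷ α)     = ⊥-elim (i≢j ≡.refl)
  D-τ-comm zero    (suc zero)    i≢j i≢1+j φ (a ∷ α)     = ⊥-elim (i≢1+j ≡.refl)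
  D-τ-comm zero    (suc (suc i)) i≢j i≢1+j φ (a ∷ [])    = refl
  D-τ-comm zero    (suc (suc i)) i≢j i≢1+j φ (a ∷ b ∷ α) = τ-D₂ i (λ p q β → φ (p ∷ q ∷ β)) a b α
  D-τ-comm (suc j) zero          i≢j i≢1+j φ (a ∷ α)     = refl
  D-τ-comm (suc j) (suc i)       i≢j i≢1+j φ (a ∷ α)     =
    D-τ-comm j i (λ e → i≢j (≡.cong suc e)) (λ e → i≢1+j (≡.cong suc e)) (λ β → φ (a ∷ β)) α

  D-τ-sum : ∀ {L} j (φ : Func L) → D j (τ j φ ⊹ τ (suc j) φ) ≋ τ j (D j φ) ⊹ τ (suc j) (D j φ)
  D-τ-sum j       φ []          = sym (+-identityˡ 0#)
  D-τ-sum zero    φ (a ∷ [])    = sym (+-identityˡ 0#)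
  D-τ-sum zero    φ (a ∷ b ∷ α) = D₂-sum (λ p q → φ (p ∷ q ∷ α)) a b
  D-τ-sum (suc j) φ (a ∷ α)     = D-τ-sum j (λ β → φ (a ∷ β)) α

  D-τ-product : ∀ {L} j (φ : Func L) → D j (τ j (τ (suc j) φ)) ≋ τ j (τ (suc j) (D j φ))
  D-τ-product j       φ []          = refl
  D-τ-product zero    φ (a ∷ [])    = refl
  D-τ-product zero    φ (a ∷ b ∷ α) = D₂-product (λ p q → φ (p ∷ q ∷ α)) a b
  D-τ-product (suc j) φ (a ∷ α)     = D-τ-product j (λ β → φ (a ∷ β)) α

  -- E M m and H M m are dual to multiplication by e_m(x₀,…,x_{M-1}) and
  -- h_m(x₀,…,x_{M-1}).
  E : ∀ {L} → ℕ → ℕ → Func L → Func L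
  E M       zero    φ = φ
  E zero    (suc m) φ = 𝟘
  E (suc M) (suc m) φ = E M (suc m) φ ⊹ τ M (E M m φ)

  H : ∀ {L} → ℕ → ℕ → Func L → Func L
  H M       zero    φ = φ
  H zero    (suc m) φ = 𝟘
  H (suc M) (suc m) φ = H M (suc m) φ ⊹ τ M (H (suc M) m φ)

  E-additive : ∀ {L} M m → Additive {L} (E M m)
  E-additive M m = record { cong = E-cong M m ; homo = E-homo M m }
    where
    E-cong : ∀ {L} M m {φ ψ : Func L} → φ ≋ ψ → E M m φ ≋ E M m ψ
    E-cong M       zero    p = p
    E-cong zero    (suc m) p = ≋-refl
    E-cong (suc M) (suc m) p = ⊹-cong (E-cong M (suc m) p) (cong (τ-additive M) (E-cong M m p))
    E-homo : ∀ {L} M m (φ ψ : Func L) → E M m (φ ⊹ ψ) ≋ E M m φ ⊹ E M m ψ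
    E-homo M       zero    φ ψ α = refl
    E-homo zero    (suc m) φ ψ α = sym (+-identityˡ 0#)
    E-homo (suc M) (suc m) φ ψ α = trans
      (+-cong (E-homo M (suc m) φ ψ α)
        (trans (cong (τ-additive M) (E-homo M m φ ψ) α) (homo (τ-additive M) _ _ α)))
      (interchange _ _ _ _)

  H-additive : ∀ {L} M m → Additive {L} (H M m)
  H-additive M m = record { cong = H-cong M m ; homo = H-homo M m }
    where
    H-cong : ∀ {L} M m {φ ψ : Func L} → φ ≋ ψ → H M m φ ≋ H M m ψ
    H-cong M       zero    p = p
    H-cong zero    (suc m) p = ≋-refl
    H-cong (suc M) (suc m) p = ⊹-cong (H-cong M (suc m) p) (cong (τ-additive M) (H-cong (suc M) m p))
    H-homo : ∀ {L} M m (φ ψ : Func L) → H M m (φ ⊹ ψ) ≋ H M m φ ⊹ H M m ψ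
    H-homo M       zero    φ ψ α = refl
    H-homo zero    (suc m) φ ψ α = sym (+-identityˡ 0#)
    H-homo (suc M) (suc m) φ ψ α = trans
      (+-cong (H-homo M (suc m) φ ψ α)
        (trans (cong (τ-additive M) (H-homo (suc M) m φ ψ) α) (homo (τ-additive M) _ _ α)))
      (interchange _ _ _ _)

  -- Divided differences commute with symmetric polynomials

  Commute : ∀ {L} → (Func L → Func L) → (Func L → Func L) → Set (c ⊔ ℓ)
  Commute S T = ∀ φ → S (T φ) ≋ T (S φ)

  module _ {L : ℕ} {T : Func L → Func L} (T-additive : Additive T) where

    -- The variables x_v with v ≥ M₀ are adjoined one at a time. Taking M₀ = j + 2 treats x_j and
    -- x_{j+1} as a block, since `D j` commutes with neither of them separately; M₀ = 0 serves
    -- operators that commute with every single variable involved.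
    E-comm : ∀ M₀ p → (∀ m → Commute T (E M₀ m)) →
             (∀ v → M₀ ≤ v → v < p ℕ.+ M₀ → Commute T (τ v)) →
             ∀ m → Commute T (E (p ℕ.+ M₀) m)
    E-comm M₀ zero    base step m       φ = base m φ
    E-comm M₀ (suc p) base step zero    φ = ≋-refl
    E-comm M₀ (suc p) base step (suc m) φ = ≋-trans (homo T-additive _ _)
      (⊹-cong (ih (suc m) φ)
        (≋-trans (step (p ℕ.+ M₀) (ℕ.m≤n+m M₀ p) ℕ.≤-refl _)
                 (cong (τ-additive (p ℕ.+ M₀)) (ih m φ))))
      where
      ih : ∀ m → Commute T (E (p ℕ.+ M₀) m)
      ih = E-comm M₀ p base (λ v lo hi → step v lo (ℕ.m<n⇒m<1+n hi))

    H-comm : ∀ M₀ p → (∀ m → Commute T (H M₀ m)) →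
             (∀ v → M₀ ≤ v → v < p ℕ.+ M₀ → Commute T (τ v)) →
             ∀ m → Commute T (H (p ℕ.+ M₀) m)
    H-comm M₀ zero    base step m       φ = base m φ
    H-comm M₀ (suc p) base step zero    φ = ≋-refl
    H-comm M₀ (suc p) base step (suc m) φ = ≋-trans (homo T-additive _ _)
      (⊹-cong (H-comm M₀ p base (λ v lo hi → step v lo (ℕ.m<n⇒m<1+n hi)) (suc m) φ)
        (≋-trans (step (p ℕ.+ M₀) (ℕ.m≤n+m M₀ p) ℕ.≤-refl _)
                 (cong (τ-additive (p ℕ.+ M₀)) (H-comm M₀ (suc p) base step m φ))))

    private
      zero-base : ∀ {S : ℕ → ℕ → Func L → Func L} → (∀ φ → S 0 0 φ ≋ φ) → (∀ m φ → S 0 (suc m) φ ≋ 𝟘) →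
                  ∀ m → Commute T (S 0 m)
      zero-base S₀ S₊ zero    φ = ≋-trans (cong T-additive (S₀ φ)) (≋-sym (S₀ (T φ)))
      zero-base S₀ S₊ (suc m) φ = ≋-trans (kills T-additive (S₊ m φ)) (≋-sym (S₊ m (T φ)))

    E-comm₀ : ∀ M → (∀ v → v < M → Commute T (τ v)) → ∀ m → Commute T (E M m)
    E-comm₀ M h m = ≡.subst (λ M → Commute T (E M m)) (ℕ.+-identityʳ M)
      (E-comm 0 M (zero-base {E} (λ _ → ≋-refl) (λ _ _ → ≋-refl))
        (λ v _ v< → h v (≡.subst (v <_) (ℕ.+-identityʳ M) v<)) m)

    H-comm₀ : ∀ M → (∀ v → v < M → Commute T (τ v)) → ∀ m → Commute T (H M m)
    H-comm₀ M h m = ≡.subst (λ M → Commute T (H M m)) (ℕ.+-identityʳ M)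
      (H-comm 0 M (zero-base {H} (λ _ → ≋-refl) (λ _ _ → ≋-refl))
        (λ v _ v< → h v (≡.subst (v <_) (ℕ.+-identityʳ M) v<)) m)

  D-E-comm-lower : ∀ {L} j M → M ≤ j → ∀ m → Commute {L} (D j) (E M m)
  D-E-comm-lower j M M≤j = E-comm₀ (D-additive j) M
    (λ v v<M → D-τ-comm j v (ℕ.<⇒≢ (ℕ.<-≤-trans v<M M≤j))
                            (ℕ.<⇒≢ (ℕ.m<n⇒m<1+n (ℕ.<-≤-trans v<M M≤j))))

  D-H-comm-lower : ∀ {L} j M → M ≤ j → ∀ m → Commute {L} (D j) (H M m)
  D-H-comm-lower j M M≤j = H-comm₀ (D-additive j) M
    (λ v v<M → D-τ-comm j v (ℕ.<⇒≢ (ℕ.<-≤-trans v<M M≤j))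
                            (ℕ.<⇒≢ (ℕ.m<n⇒m<1+n (ℕ.<-≤-trans v<M M≤j))))

  τ-E-comm : ∀ {L} j M m → Commute {L} (τ j) (E M m)
  τ-E-comm j M = E-comm₀ (τ-additive j) M (λ v _ → τ-comm j v)

  τ-H-comm : ∀ {L} j M m → Commute {L} (τ j) (H M m)
  τ-H-comm j M = H-comm₀ (τ-additive j) M (λ v _ → τ-comm j v)

  -- Expansion of the product of all 1 + x_v t along its last two factors, whose coefficients x_j +
  -- x_{j+1} and x_j x_{j+1} commute with ∂_j.
  E-split : ∀ {L} j m (φ : Func L) → E (2 ℕ.+ j) (2 ℕ.+ m) φ ≋
    (E j (2 ℕ.+ m) φ ⊹ (τ j (E j (suc m) φ) ⊹ τ (suc j) (E j (suc m) φ))) ⊹ τ j (τ (suc j) (E j m φ))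
  E-split j m φ α = trans
    (+-congˡ (trans (homo (τ-additive (suc j)) _ _ α) (+-congˡ (τ-comm (suc j) j _ α))))
    (solve 4 (λ w x y z → (w ⊕ x) ⊕ (y ⊕ z) ⊜ (w ⊕ (x ⊕ y)) ⊕ z) refl _ _ _ _)

  D-E-comm-pair : ∀ {L} j m → Commute {L} (D j) (E (2 ℕ.+ j) m)
  D-E-comm-pair j zero          φ = ≋-refl
  D-E-comm-pair j (suc zero)    φ α = begin
    D j ((E j 1 φ ⊹ τ j φ) ⊹ τ (suc j) φ) α
      ≈⟨ cong Dj (λ β → +-assoc _ _ _) α ⟩
    D j (E j 1 φ ⊹ (τ j φ ⊹ τ (suc j) φ)) α
      ≈⟨ homo Dj _ _ α ⟩
    D j (E j 1 φ) α + D j (τ j φ ⊹ τ (suc j) φ) α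
      ≈⟨ +-cong (D-E-comm-lower j j ℕ.≤-refl 1 φ α) (D-τ-sum j φ α) ⟩
    E j 1 (D j φ) α + (τ j (D j φ) α + τ (suc j) (D j φ) α)
      ≈⟨ +-assoc _ _ _ ⟨
    E (2 ℕ.+ j) 1 (D j φ) α ∎
    where
    open SetoidReasoning setoid
    Dj = D-additive j
  D-E-comm-pair j (suc (suc m)) φ α = begin
    D j (E (2 ℕ.+ j) (2 ℕ.+ m) φ) α
      ≈⟨ cong Dj (E-split j m φ) α ⟩
    D j ((E j (2 ℕ.+ m) φ ⊹ (τ j ψ ⊹ τ (suc j) ψ)) ⊹ τ j (τ (suc j) χ)) α
      ≈⟨ trans (homo Dj _ _ α) (+-congʳ (homo Dj _ _ α)) ⟩
    (D j (E j (2 ℕ.+ m) φ) α + D j (τ j ψ ⊹ τ (suc j) ψ) α) + D j (τ j (τ (suc j) χ)) α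
      ≈⟨ +-cong (+-cong (lower (2 ℕ.+ m) φ α) (D-τ-sum j ψ α)) (D-τ-product j χ α) ⟩
    (E j (2 ℕ.+ m) (D j φ) α + (τ j (D j ψ) α + τ (suc j) (D j ψ) α)) + τ j (τ (suc j) (D j χ)) α
      ≈⟨ +-cong (+-congˡ (+-cong (cong (τ-additive j) (lower (suc m) φ) α)
                                 (cong (τ-additive (suc j)) (lower (suc m) φ) α)))
                (cong (τ-additive j) (cong (τ-additive (suc j)) (lower m φ)) α) ⟩
    _ ≈⟨ E-split j m (D j φ) α ⟨
    E (2 ℕ.+ j) (2 ℕ.+ m) (D j φ) α ∎
    where
    open SetoidReasoning setoid
    Dj = D-additive j
    ψ = E j (suc m) φ
    χ = E j m φ
    lower = D-E-comm-lower j j ℕ.≤-refl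

  -- Multiplying the generating series of the h_m(x₀,...,x_{j+1}) by (1 - x_j t)(1 - x_{j+1} t)
  -- leaves that of the h_m(x₀,...,x_{j-1}); the negative terms stand on the other side.
  H-split : ∀ {L} j m (φ : Func L) →
    H (2 ℕ.+ j) (2 ℕ.+ m) φ ⊹ τ j (τ (suc j) (H (2 ℕ.+ j) m φ)) ≋
    H j (2 ℕ.+ m) φ ⊹ (τ j (H (2 ℕ.+ j) (suc m) φ) ⊹ τ (suc j) (H (2 ℕ.+ j) (suc m) φ))
  H-split j m φ α = trans
    (solve 4 (λ w x y z → ((w ⊕ x) ⊕ y) ⊕ z ⊜ w ⊕ ((x ⊕ z) ⊕ y)) refl _ _ _ _)
    (+-congˡ (+-congʳ (sym (homo (τ-additive j) _ _ α))))

  D-H-comm-pair : ∀ {L} j m → Commute {L} (D j) (H (2 ℕ.+ j) m)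
  D-H-comm-pair j zero          φ = ≋-refl
  D-H-comm-pair j (suc zero)    φ α = begin
    D j ((H j 1 φ ⊹ τ j φ) ⊹ τ (suc j) φ) α
      ≈⟨ cong Dj (λ β → +-assoc _ _ _) α ⟩
    D j (H j 1 φ ⊹ (τ j φ ⊹ τ (suc j) φ)) α
      ≈⟨ homo Dj _ _ α ⟩
    D j (H j 1 φ) α + D j (τ j φ ⊹ τ (suc j) φ) α
      ≈⟨ +-cong (D-H-comm-lower j j ℕ.≤-refl 1 φ α) (D-τ-sum j φ α) ⟩
    H j 1 (D j φ) α + (τ j (D j φ) α + τ (suc j) (D j φ) α)
      ≈⟨ +-assoc _ _ _ ⟨
    H (2 ℕ.+ j) 1 (D j φ) α ∎
    where
    open SetoidReasoning setoid
    Dj = D-additive j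
  -- `H-split` determines h_{m+2} only together with x_j x_{j+1} h_m, so that term is added, handled
  -- by induction on the degree, and cancelled.
  D-H-comm-pair j (suc (suc m)) φ α = +-cancelʳ (τ j (τ (suc j) (H (2 ℕ.+ j) m (D j φ))) α) _ _ (begin
    D j (H (2 ℕ.+ j) (2 ℕ.+ m) φ) α + τ j (τ (suc j) (H (2 ℕ.+ j) m (D j φ))) α
      ≈⟨ +-congˡ (cong (τ-additive j) (cong (τ-additive (suc j)) (D-H-comm-pair j m φ)) α) ⟨
    D j (H (2 ℕ.+ j) (2 ℕ.+ m) φ) α + τ j (τ (suc j) (D j χ)) α
      ≈⟨ +-congˡ (D-τ-product j χ α) ⟨
    D j (H (2 ℕ.+ j) (2 ℕ.+ m) φ) α + D j (τ j (τ (suc j) χ)) α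
      ≈⟨ homo Dj _ _ α ⟨
    D j (H (2 ℕ.+ j) (2 ℕ.+ m) φ ⊹ τ j (τ (suc j) χ)) α
      ≈⟨ cong Dj (H-split j m φ) α ⟩
    D j (H j (2 ℕ.+ m) φ ⊹ (τ j ψ ⊹ τ (suc j) ψ)) α
      ≈⟨ homo Dj _ _ α ⟩
    D j (H j (2 ℕ.+ m) φ) α + D j (τ j ψ ⊹ τ (suc j) ψ) α
      ≈⟨ +-cong (D-H-comm-lower j j ℕ.≤-refl (2 ℕ.+ m) φ α) (D-τ-sum j ψ α) ⟩
    H j (2 ℕ.+ m) (D j φ) α + (τ j (D j ψ) α + τ (suc j) (D j ψ) α)
      ≈⟨ +-congˡ (+-cong (cong (τ-additive j) (D-H-comm-pair j (suc m) φ) α)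
                         (cong (τ-additive (suc j)) (D-H-comm-pair j (suc m) φ) α)) ⟩
    _ ≈⟨ H-split j m (D j φ) α ⟨
    H (2 ℕ.+ j) (2 ℕ.+ m) (D j φ) α + τ j (τ (suc j) (H (2 ℕ.+ j) m (D j φ))) α ∎)
    where
    open SetoidReasoning setoid
    Dj = D-additive j
    ψ = H (2 ℕ.+ j) (suc m) φ
    χ = H (2 ℕ.+ j) m φ

  D-τ-comm-upper : ∀ {L} j v → 2 ℕ.+ j ≤ v → Commute {L} (D j) (τ v)
  D-τ-comm-upper j v 2+j≤v = D-τ-comm j v
    (ℕ.>⇒≢ (ℕ.<-trans (ℕ.n<1+n j) 2+j≤v)) (ℕ.>⇒≢ 2+j≤v)

  D-E-comm-upper : ∀ {L} j M → 2 ℕ.+ j ≤ M → ∀ m → Commute {L} (D j) (E M m)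
  D-E-comm-upper j M 2+j≤M m = ≡.subst (λ M → Commute (D j) (E M m)) (ℕ.m∸n+n≡m 2+j≤M)
    (E-comm (D-additive j) (2 ℕ.+ j) (M ℕ.∸ (2 ℕ.+ j)) (D-E-comm-pair j) (λ v lo _ → D-τ-comm-upper j v lo) m)

  D-H-comm-upper : ∀ {L} j M → 2 ℕ.+ j ≤ M → ∀ m → Commute {L} (D j) (H M m)
  D-H-comm-upper j M 2+j≤M m = ≡.subst (λ M → Commute (D j) (H M m)) (ℕ.m∸n+n≡m 2+j≤M)
    (H-comm (D-additive j) (2 ℕ.+ j) (M ℕ.∸ (2 ℕ.+ j)) (D-H-comm-pair j) (λ v lo _ → D-τ-comm-upper j v lo) m)

  -- Functionals attached to Lehmer codes

  -- Dual to ∂_{i+a-1} ⋯ ∂_{i+1} ∂_i, the cycle contributed by an entry a at position i of a Lehmer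
  -- code.
  C : ∀ {L} → ℕ → ℕ → Func L → Func L
  C i zero    φ = φ
  C i (suc a) φ = D i (C (suc i) a φ)

  -- Dual to the divided difference ∂_w for the permutation w with Lehmer code as,
  -- acting on the variables from x_i on.
  Λ : ∀ {L N} → ℕ → Vec ℕ N → Func L → Func L
  Λ i []       φ = φ
  Λ i (a ∷ as) φ = Λ (suc i) as (C i a φ)

  C-additive : ∀ {L} i a → Additive {L} (C i a)
  C-additive i zero    = record { cong = λ p → p ; homo = λ φ ψ → ≋-refl }
  C-additive i (suc a) = record
    { cong = λ p → cong (D-additive i) (cong (C-additive (suc i) a) p)
    ; homo = λ φ ψ → ≋-trans (cong (D-additive i) (homo (C-additive (suc i) a) φ ψ))
                             (homo (D-additive i) _ _) }

  Λ-additive : ∀ {L N} i (as : Vec ℕ N) → Additive {L} (Λ i as)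
  Λ-additive i []       = record { cong = λ p → p ; homo = λ φ ψ → ≋-refl }
  Λ-additive i (a ∷ as) = record
    { cong = λ p → cong (Λ-additive (suc i) as) (cong (C-additive i a) p)
    ; homo = λ φ ψ → ≋-trans (cong (Λ-additive (suc i) as) (homo (C-additive i a) φ ψ))
                             (homo (Λ-additive (suc i) as) _ _) }

  C-+ : ∀ {L} i s t (φ : Func L) → C i (s ℕ.+ t) φ ≡ C i s (C (s ℕ.+ i) t φ)
  C-+ i zero    t φ = ≡.refl
  C-+ i (suc s) t φ = ≡.cong (D i) (≡.trans (C-+ (suc i) s t φ)
    (≡.cong (λ x → C (suc i) s (C x t φ)) (ℕ.+-suc s i)))

  C-kills : ∀ {L} {S : Func L → Func L} i a → (∀ j → i ≤ j → j < a ℕ.+ i → Commute (D j) S) →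
            ∀ {φ} → S φ ≋ 𝟘 → S (C i a φ) ≋ 𝟘
  C-kills i zero    comm Sφ = Sφ
  C-kills {S = S} i (suc a) comm {φ} Sφ = ≋-trans (≋-sym (comm i ℕ.≤-refl (s≤s (ℕ.m≤n+m i a)) _))
    (kills (D-additive i) (C-kills {S = S} (suc i) a
      (λ j lo hi → comm j (ℕ.<⇒≤ lo) (≡.subst (j <_) (ℕ.+-suc a i) hi)) Sφ))

  -- Vanishing on the elementary symmetric polynomials

  KillE : ∀ {L} → Func L → ℕ → ℕ → Set ℓ
  KillE φ M d = ∀ m → d < m → E M m φ ≋ 𝟘

  C-keeps-KillE : ∀ {L} i a M d {φ : Func L} → a ℕ.+ i < M → KillE φ M d → KillE (C i a φ) M d
  C-keeps-KillE i a M d a+i<M killed m d<m = C-kills {S = E M m} i a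
    (λ j _ hi → D-E-comm-upper j M (ℕ.<-≤-trans (s≤s hi) a+i<M) m) (killed m d<m)

  -- The cycle is cut at index s + i. The divided differences from there on leave x₀,...,x_{s+i-1}
  -- alone. Adjoining x_{s+i} to the segment costs one degree, by e_m = e_m′ + x_{s+i} e_{m-1}′ with
  -- e′ in the shorter segment. The remaining ones only permute variables of the longer segment.
  C-raises-KillE : ∀ {L} i s t d {φ : Func L} → KillE φ (s ℕ.+ i) d →
                   KillE (C i (s ℕ.+ t) φ) (s ℕ.+ suc i) (suc d)
  C-raises-KillE i s t d {φ} killed =
    ≡.subst₂ (λ χ M → KillE χ M (suc d)) (≡.sym (C-+ i s t φ)) (≡.sym (ℕ.+-suc s i))
      (C-keeps-KillE i s (suc (s ℕ.+ i)) (suc d) ℕ.≤-refl raised)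
    where
    ψ = C (s ℕ.+ i) t φ
    killedψ : KillE ψ (s ℕ.+ i) d
    killedψ m d<m = C-kills {S = E (s ℕ.+ i) m} (s ℕ.+ i) t
      (λ j lo _ → D-E-comm-lower j (s ℕ.+ i) lo m) (killed m d<m)
    raised : KillE ψ (suc (s ℕ.+ i)) (suc d)
    raised (suc m) (s≤s d<m) α = trans
      (+-cong (killedψ (suc m) (ℕ.m<n⇒m<1+n d<m) α) (kills (τ-additive (s ℕ.+ i)) (killedψ m d<m) α))
      (+-identityˡ 0#)

  -- The segment always has s + i variables. An entry < s lowers s while i grows, so segment and
  -- threshold d stay; an entry ≥ s lengthens the segment and raises d by one. Since s must end at
  -- 0, exactly N - s entries are of the second kind, and the threshold ends at d + N - s.
  Λ-kills-E : ∀ {L N} i r s d (as : Vec ℕ N) {φ : Func L} → Admissible r s as →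
              KillE φ (s ℕ.+ i) d →
              ∀ m → d ℕ.+ N < m ℕ.+ s → E (N ℕ.+ i) m (Λ i as φ) ≋ 𝟘
  Λ-kills-E i r .0 d [] ≡.refl killed m lt =
    killed m (≡.subst₂ _<_ (ℕ.+-identityʳ d) (ℕ.+-identityʳ m) lt)
  Λ-kills-E {N = suc N} i r zero d (a ∷ as) {φ} (_ , adm) killed m lt =
    ≡.subst (λ M → E M m (Λ i (a ∷ as) φ) ≋ 𝟘) (ℕ.+-suc N i)
      (Λ-kills-E (suc i) r zero (suc d) as adm (C-raises-KillE i 0 a d killed) m
        (≡.subst (_< m ℕ.+ 0) (ℕ.+-suc d N) lt))
  Λ-kills-E {N = suc N} i r (suc s) d (a ∷ as) {φ} (inj₁ (a<1+s , adm)) killed m lt =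
    ≡.subst (λ M → E M m (Λ i (a ∷ as) φ) ≋ 𝟘) (ℕ.+-suc N i)
      (Λ-kills-E (suc i) (suc r) s d as adm
        (≡.subst (λ M → KillE (C i a φ) M d) (≡.sym (ℕ.+-suc s i))
          (C-keeps-KillE i a (suc s ℕ.+ i) d (ℕ.+-monoˡ-< i a<1+s) killed))
        m (ℕ.≤-pred (≡.subst₂ _<_ (ℕ.+-suc d N) (ℕ.+-suc m s) lt)))
  Λ-kills-E {N = suc N} i r (suc s) d (a ∷ as) {φ} (inj₂ ((s<a , _) , adm)) killed m lt =
    ≡.subst (λ M → E M m (Λ i (a ∷ as) φ) ≋ 𝟘) (ℕ.+-suc N i)
      (Λ-kills-E (suc i) r (suc s) (suc d) as adm
        (≡.subst (λ a → KillE (C i a φ) (suc s ℕ.+ suc i) (suc d)) (ℕ.m+[n∸m]≡n s<a)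
          (C-raises-KillE i (suc s) (a ℕ.∸ suc s) d killed))
        m (≡.subst (_< m ℕ.+ suc s) (ℕ.+-suc d N) lt))

  -- Vanishing on the complete homogeneous polynomials

  KillH : ∀ {L} → Func L → ℕ → Set ℓ
  KillH φ M = ∀ m → H M (suc m) φ ≋ 𝟘

  C-keeps-KillH : ∀ {L} i a M {φ : Func L} → a ℕ.+ i < M → KillH φ M → KillH (C i a φ) M
  C-keeps-KillH i a M a+i<M killed m = C-kills {S = H M (suc m)} i a
    (λ j _ hi → D-H-comm-upper j M (ℕ.<-≤-trans (s≤s hi) a+i<M) (suc m)) (killed m)

  -- By h_{m+1}(x₀,...,x_{i-1}) = h_{m+1}(x₀,...,x_i) - x_i h_m(x₀,...,x_i), each variable dropped
  -- from the segment costs one degree.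
  KillH-descends : ∀ {L} p i {φ : Func L} → KillH φ (p ℕ.+ i) → ∀ m → p < m → H i m φ ≋ 𝟘
  KillH-descends zero    i killed (suc m) p<m = killed m
  KillH-descends (suc p) i {φ} killed (suc m) (s≤s p<m) α = begin
    H i (suc m) φ α
      ≈⟨ +-identityʳ _ ⟨
    H i (suc m) φ α + 0#
      ≈⟨ +-congˡ (kills (τ-additive i) (above m p<m) α) ⟨
    H (suc i) (suc m) φ α
      ≈⟨ above (suc m) (ℕ.m<n⇒m<1+n p<m) α ⟩
    0# ∎
    where
    open SetoidReasoning setoid
    above = KillH-descends p (suc i) (≡.subst (KillH φ) (≡.sym (ℕ.+-suc p i)) killed)

  Λ-keeps-H : ∀ {L N} i M m (as : Vec ℕ N) {φ : Func L} → M ≤ i → H M m φ ≋ 𝟘 → H M m (Λ i as φ) ≋ 𝟘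
  Λ-keeps-H i M m []       M≤i killed = killed
  Λ-keeps-H i M m (a ∷ as) M≤i killed = Λ-keeps-H (suc i) M m as (ℕ.m≤n⇒m≤1+n M≤i)
    (C-kills {S = H M m} i a (λ j i≤j _ → D-H-comm-lower j M (ℕ.≤-trans M≤i i≤j) m) killed)

  -- An entry ≤ k at position i involves no variable beyond x_{i+k}, so vanishing survives on
  -- segments of at least k + i + 1 variables. Dropping k variables from the shortest of these
  -- reaches h_{k+1}(x₀,...,x_i), and the later entries act only from x_{i+1} on.
  Λ-kills-H : ∀ {L N} i k (as : Vec ℕ N) {φ : Func L} → VAll (_< suc k) as →
              (∀ M → k ℕ.+ i ≤ M → KillH φ M) →
              ∀ l → l < N → H (suc (l ℕ.+ i)) (suc k) (Λ i as φ) ≋ 𝟘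
  Λ-kills-H i k (a ∷ as) {φ} (a<k ∷ as<k) killed = λ
    { zero    _         → Λ-keeps-H (suc i) (suc i) (suc k) as ℕ.≤-refl
        (KillH-descends k (suc i) (killed′ (k ℕ.+ suc i) ℕ.≤-refl) (suc k) ℕ.≤-refl)
    ; (suc l) (s≤s l<N) → ≡.subst (λ M → H (suc M) (suc k) (Λ i (a ∷ as) φ) ≋ 𝟘) (ℕ.+-suc l i)
        (Λ-kills-H (suc i) k as as<k killed′ l l<N) }
    where
    killed′ : ∀ M → k ℕ.+ suc i ≤ M → KillH (C i a φ) M
    killed′ M k+i<M = C-keeps-KillH i a M
      (ℕ.<-≤-trans (ℕ.+-monoˡ-< i a<k) (≡.subst (_≤ M) (ℕ.+-suc k i) k+i<M))
      (killed M (ℕ.≤-trans (ℕ.+-monoʳ-≤ k (ℕ.n≤1+n i)) k+i<M))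

  -- Evaluation at the origin and unitriangularity

  ε : ∀ {L} → Func L
  ε []          = 1#
  ε (zero ∷ α)  = ε α
  ε (suc _ ∷ α) = 0#

  τ-ε : ∀ {L} j → τ {L} j ε ≋ 𝟘
  τ-ε j       []          = refl
  τ-ε zero    (a ∷ α)     = refl
  τ-ε (suc j) (zero ∷ α)  = τ-ε j α
  τ-ε (suc j) (suc _ ∷ α) = kills (τ-additive j) (λ _ → refl) α

  ε-KillE : ∀ {L} M → KillE {L} ε M 0
  ε-KillE zero    (suc m) _ α = refl
  ε-KillE (suc M) (suc m) _ α = trans
    (+-cong (ε-KillE M (suc m) (s≤s z≤n) α)
      (trans (τ-E-comm M M m ε α) (kills (E-additive M m) (τ-ε M) α)))
    (+-identityˡ 0#)

  ε-KillH : ∀ {L} M → KillH {L} ε M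
  ε-KillH zero    m α = refl
  ε-KillH (suc M) m α = trans
    (+-cong (ε-KillH M m α)
      (trans (τ-H-comm M (suc M) m ε α) (kills (H-additive (suc M) m) (τ-ε M) α)))
    (+-identityˡ 0#)

  module _ where
    open AbelianGroupProperties +-abelianGroup using () renaming (ε⁻¹≈ε to -0≈0)

    -- As g vanishes on multiples of x, only ∂f modulo x matters: ∂ sends y^{c+1} to - y^c, x^{b+1}
    -- to y^b, and x^{b+1} y^{c+1} to x y ∂(x^b y^c), which is 0 modulo x. These are the three
    -- lemmas from here on.
    D₂-δ : ∀ g → (∀ p q → g (suc p) q ≈ 0#) → ∀ c → D₂ g zero (suc c) ≈ - g zero c
    D₂-δ g g≈0 c = trans (+-congˡ (trans (D₂-cong g≈0 zero c) (D₂-0 zero c))) (+-identityʳ _)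

    D₂-δ-zero : ∀ g → (∀ p q → g (suc p) q ≈ 0#) → ∀ b → D₂ g (suc b) zero ≈ g zero b
    D₂-δ-zero g g≈0 zero    = +-identityʳ _
    D₂-δ-zero g g≈0 (suc b) = trans
      (+-cong (g≈0 b zero) (D₂-δ-zero (λ p q → g p (suc q)) (λ p q → g≈0 p (suc q)) b)) (+-identityˡ _)

    D₂-δ-suc : ∀ g → (∀ p q → g (suc p) q ≈ 0#) → ∀ b c → D₂ g (suc b) (suc c) ≈ 0#
    D₂-δ-suc g g≈0 zero    c = trans (+-congˡ (D₂-δ (λ p q → g p (suc q)) (λ p q → g≈0 p (suc q)) c)) (-‿inverseʳ _)
    D₂-δ-suc g g≈0 (suc b) c = trans
      (+-cong (g≈0 b (suc c)) (D₂-δ-suc (λ p q → g p (suc q)) (λ p q → g≈0 p (suc q)) b c)) (+-identityˡ _)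

  C-shift : ∀ {L} i a (φ : Func (suc L)) b → (λ β → C (suc i) a φ (b ∷ β)) ≋ C i a (λ β → φ (b ∷ β))
  C-shift i zero    φ b = ≋-refl
  C-shift i (suc a) φ b = cong (D-additive i) (C-shift (suc i) a φ b)

  -- From index 1 on nothing touches x₀, so its exponent is a parameter.
  Λ-shift : ∀ {L N} i (as : Vec ℕ N) (φ : Func (suc L)) b →
            (λ β → Λ (suc i) as φ (b ∷ β)) ≋ Λ i as (λ β → φ (b ∷ β))
  Λ-shift i []       φ b = ≋-refl
  Λ-shift i (a ∷ as) φ b = ≋-trans (Λ-shift (suc i) as (C (suc i) a φ) b)
    (cong (Λ-additive (suc i) as) (C-shift i a φ b))

  C-ε-vanishing : ∀ {L} a p (β : Vec ℕ L) → C 1 a ε (suc p ∷ β) ≈ 0#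
  C-ε-vanishing a p β = trans (C-shift 0 a ε (suc p) β) (kills (C-additive 0 a) (λ _ → refl) β)

  -- For b ≥ a, ∂_{a-1} ⋯ ∂_0 sends x₀^b to h_{b-a}(x₀,...,x_a), with constant term 1 if b = a and 0
  -- if b > a. A nontrivial further factor x^β leaves positive degree, hence no constant term. The
  -- bound a ≤ L ensures that x_a exists.
  C-ε-diagonal : ∀ {L} a → a ≤ L → (λ (β : Vec ℕ L) → C 0 a ε (a ∷ β)) ≋ ε
  C-ε-diagonal zero    _         β           = refl
  C-ε-diagonal (suc a) (s≤s a≤L) (zero ∷ β)  = trans
    (D₂-δ-zero (λ p q → C 1 a ε (p ∷ q ∷ β)) (λ p q → C-ε-vanishing a p (q ∷ β)) a)
    (trans (C-shift 0 a ε 0 (a ∷ β)) (C-ε-diagonal a a≤L β))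
  C-ε-diagonal (suc a) (s≤s a≤L) (suc c ∷ β) = D₂-δ-suc (λ p q → C 1 a ε (p ∷ q ∷ β)) (λ p q → C-ε-vanishing a p (q ∷ β)) a c

  C-ε-above : ∀ {L} a b → a ≤ L → a < b → (λ (β : Vec ℕ L) → C 0 a ε (b ∷ β)) ≋ 𝟘
  C-ε-above zero    (suc b) _         _         β           = refl
  C-ε-above (suc a) (suc b) (s≤s a≤L) (s≤s a<b) (zero ∷ β)  = trans
    (D₂-δ-zero (λ p q → C 1 a ε (p ∷ q ∷ β)) (λ p q → C-ε-vanishing a p (q ∷ β)) b)
    (trans (C-shift 0 a ε 0 (b ∷ β)) (C-ε-above a b a≤L a<b β))
  C-ε-above (suc a) (suc b) (s≤s a≤L) (s≤s a<b) (suc c ∷ β) = D₂-δ-suc (λ p q → C 1 a ε (p ∷ q ∷ β)) (λ p q → C-ε-vanishing a p (q ∷ β)) b c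

  zeros : ∀ K → Vec ℕ K
  zeros K = V.replicate K 0

  ε-zeros : ∀ K → ε (zeros K) ≈ 1#
  ε-zeros zero    = refl
  ε-zeros (suc K) = ε-zeros K

  -- The K trailing variables make room for an entry below K at every position, including the last.
  Λ-diagonal : ∀ {N} K (as : Vec ℕ N) → VAll (_< K) as → Λ 0 as ε (as V.++ zeros K) ≈ 1#
  Λ-diagonal K []       _              = ε-zeros K
  Λ-diagonal {suc N} K (a ∷ as) (a<K ∷ as<K) = trans (Λ-shift 0 as (C 0 a ε) a _)
    (trans (cong (Λ-additive 0 as) (C-ε-diagonal a (ℕ.≤-trans (ℕ.<⇒≤ a<K) (ℕ.m≤n+m K N))) _)
      (Λ-diagonal K as as<K))

  Λ-above : ∀ {N} K (as bs : Vec ℕ N) → VAll (_< K) as → as <ₗ bs → Λ 0 as ε (bs V.++ zeros K) ≈ 0#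
  Λ-above K [] [] _ ()
  Λ-above {suc N} K (a ∷ as) (b ∷ bs) (a<K ∷ as<K) (inj₁ a<b) = trans (Λ-shift 0 as (C 0 a ε) b _)
    (kills (Λ-additive 0 as) (C-ε-above a b (ℕ.≤-trans (ℕ.<⇒≤ a<K) (ℕ.m≤n+m K N)) a<b) _)
  Λ-above {suc N} K (a ∷ as) (a ∷ bs) (a<K ∷ as<K) (inj₂ (≡.refl , as<bs)) = trans (Λ-shift 0 as (C 0 a ε) a _)
    (trans (cong (Λ-additive 0 as) (C-ε-diagonal a (ℕ.≤-trans (ℕ.<⇒≤ a<K) (ℕ.m≤n+m K N))) _)
      (Λ-above K as bs as<K as<bs))

-- Linear independence of the admissible monomials

module Pairing {c ℓ : Level} (F : Field c ℓ) where
  open Field F hiding (zero)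
  open Poly F
  open DividedDifferences commutativeRing
  open Additive

  ⟨_,_⟩ : ∀ {n} → Func n → Pol n → Carrier
  ⟨ φ , [] ⟩          = 0#
  ⟨ φ , (a , α) ∷ p ⟩ = a * φ α + ⟨ φ , p ⟩

  ⟨⟩-cong : ∀ {n} {φ ψ : Func n} → φ ≋ ψ → ∀ p → ⟨ φ , p ⟩ ≈ ⟨ ψ , p ⟩
  ⟨⟩-cong φ≋ψ []            = refl
  ⟨⟩-cong φ≋ψ ((a , α) ∷ p) = +-cong (*-congˡ (φ≋ψ α)) (⟨⟩-cong φ≋ψ p)

  ⟨⟩-++ : ∀ {n} (φ : Func n) p q → ⟨ φ , p ++ q ⟩ ≈ ⟨ φ , p ⟩ + ⟨ φ , q ⟩
  ⟨⟩-++ φ []      q = sym (+-identityˡ _)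
  ⟨⟩-++ φ (x ∷ p) q = trans (+-congˡ (⟨⟩-++ φ p q)) (sym (+-assoc _ _ _))

  ⟨⟩-map : ∀ {n m} (f : Carrier × Mon n → Carrier × Mon m) a (g : Mon n → Mon m) → (∀ b β → f (b , β) ≡ (a * b , g β)) →
           ∀ φ p → ⟨ φ , map f p ⟩ ≈ a * ⟨ (λ β → φ (g β)) , p ⟩
  ⟨⟩-map f a g f≡ φ []            = sym (zeroʳ a)
  ⟨⟩-map f a g f≡ φ ((b , β) ∷ p) rewrite f≡ b β = trans
    (+-cong (*-assoc a b _) (⟨⟩-map f a g f≡ φ p)) (sym (distribˡ a _ _))

  ⟨⟩-· : ∀ {n} (φ : Func n) a p → ⟨ φ , a ·P p ⟩ ≈ a * ⟨ φ , p ⟩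
  ⟨⟩-· φ a p = ⟨⟩-map _ a (λ β → β) (λ b β → ≡.refl) φ p

  shift : ∀ {n} → Mon n → Func n → Func n
  shift α φ β = φ (V.zipWith ℕ._+_ α β)

  ⟨⟩-* : ∀ {n} (φ : Func n) p q → ⟨ φ , p *P q ⟩ ≈ ⟨ (λ α → ⟨ shift α φ , q ⟩) , p ⟩
  ⟨⟩-* φ []            q = refl
  ⟨⟩-* φ ((a , α) ∷ p) q = trans (⟨⟩-++ φ (map _ q) (p *P q))
    (+-cong (⟨⟩-map _ a (V.zipWith ℕ._+_ α) (λ b β → ≡.refl) φ q) (⟨⟩-* φ p q))

  ⟨⟩-sumOfMons-map : ∀ {n m} (φ : Func m) (f : Mon n → Mon m) ms →
                     ⟨ φ , sumOfMons (map f ms) ⟩ ≈ ⟨ (λ α → φ (f α)) , sumOfMons ms ⟩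
  ⟨⟩-sumOfMons-map φ f []       = refl
  ⟨⟩-sumOfMons-map φ f (α ∷ ms) = +-congˡ (⟨⟩-sumOfMons-map φ f ms)

  ⟨⟩-sumOfMons-++ : ∀ {n} (φ : Func n) ms ms′ →
                    ⟨ φ , sumOfMons (ms ++ ms′) ⟩ ≈ ⟨ φ , sumOfMons ms ⟩ + ⟨ φ , sumOfMons ms′ ⟩
  ⟨⟩-sumOfMons-++ φ ms ms′ = trans (reflexive (≡.cong ⟨ φ ,_⟩ (L.map-++ (1# ,_) ms ms′)))
    (⟨⟩-++ φ (sumOfMons ms) (sumOfMons ms′))

  -- A vanishing coefficient says nothing about single terms, since a monomial may be repeated. All
  -- its terms are discarded together, which makes induction on the length of the list possible in
  -- `⟨⟩-vanishing`.
  remove : ∀ {n} → Mon n → Pol n → Pol n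
  remove α []            = []
  remove α ((b , β) ∷ p) with ≡-dec ℕ._≟_ β α
  ... | yes _ = remove α p
  ... | no  _ = (b , β) ∷ remove α p

  length-remove : ∀ {n} (α : Mon n) p → L.length (remove α p) ≤ L.length p
  length-remove α []            = z≤n
  length-remove α ((b , β) ∷ p) with ≡-dec ℕ._≟_ β α
  ... | yes _ = ℕ.m≤n⇒m≤1+n (length-remove α p)
  ... | no  _ = s≤s (length-remove α p)

  coeff-remove : ∀ {n} (α : Mon n) p γ → coeff p γ ≈ 0# → coeff (remove α p) γ ≈ 0#
  coeff-remove α p γ with ≡-dec ℕ._≟_ α γ
  ... | yes ≡.refl = λ _ → same p
    where
    same : ∀ p → coeff (remove α p) α ≈ 0#
    same []            = refl
    same ((b , β) ∷ p) with ≡-dec ℕ._≟_ β α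
    ... | yes _ = same p
    ... | no β≢α with ≡-dec ℕ._≟_ β α
    ...   | yes β≡α = contradiction β≡α β≢α
    ...   | no  _   = same p
  ... | no α≢γ = trans (other p)
    where
    other : ∀ p → coeff (remove α p) γ ≈ coeff p γ
    other []            = refl
    other ((b , β) ∷ p) with ≡-dec ℕ._≟_ β α | ≡-dec ℕ._≟_ β γ in β≟γ
    ... | yes ≡.refl | yes α≡γ = contradiction α≡γ α≢γ
    ... | yes ≡.refl | no  _   = other p
    ... | no  _ | yes _ rewrite β≟γ = +-congˡ (other p)
    ... | no  _ | no  _ rewrite β≟γ = other p

  ⟨⟩-remove : ∀ {n} (φ : Func n) α p → ⟨ φ , p ⟩ ≈ coeff p α * φ α + ⟨ φ , remove α p ⟩
  ⟨⟩-remove φ α []            = sym (trans (+-identityʳ _) (zeroˡ _))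
  ⟨⟩-remove φ α ((b , β) ∷ p) with ≡-dec ℕ._≟_ β α
  ... | yes ≡.refl = trans (+-congˡ (⟨⟩-remove φ α p))
    (trans (sym (+-assoc _ _ _)) (+-congʳ (sym (distribʳ _ _ _))))
  ... | no  _      = trans (+-congˡ (⟨⟩-remove φ α p))
    (solve 3 (λ x y z → x ⊕ (y ⊕ z) ⊜ y ⊕ (x ⊕ z)) refl _ _ _)
    where open CMSolver +-commutativeMonoid using (solve; _⊕_; _⊜_)

  ⟨⟩-vanishing : ∀ {n} (φ : Func n) p → (∀ α → coeff p α ≈ 0#) → ⟨ φ , p ⟩ ≈ 0#
  ⟨⟩-vanishing φ p = go (L.length p) p ℕ.≤-refl
    where
    go : ∀ N p → L.length p ≤ N → (∀ α → coeff p α ≈ 0#) → ⟨ φ , p ⟩ ≈ 0#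
    go N       []            _         _  = refl
    go (suc N) ((b , β) ∷ p) (s≤s len) p≈0 = trans (⟨⟩-remove φ β ((b , β) ∷ p))
      (trans (+-cong (trans (*-congʳ (p≈0 β)) (zeroˡ _))
                     (go N (remove β ((b , β) ∷ p)) (ℕ.≤-trans shorter len)
                       (λ α → coeff-remove β ((b , β) ∷ p) α (p≈0 α))))
             (+-identityˡ 0#))
      where
      shorter : L.length (remove β ((b , β) ∷ p)) ≤ L.length p
      shorter with ≡-dec ℕ._≟_ β β
      ... | yes _   = length-remove β p
      ... | no  β≢β = contradiction ≡.refl β≢β

  δ : ∀ {n} → Mon n → Func n
  δ α β with ≡-dec ℕ._≟_ β α
  ... | yes _ = 1#
  ... | no  _ = 0#

  coeff≈⟨δ⟩ : ∀ {n} (p : Pol n) α → coeff p α ≈ ⟨ δ α , p ⟩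
  coeff≈⟨δ⟩ []            α = refl
  coeff≈⟨δ⟩ ((b , β) ∷ p) α with ≡-dec ℕ._≟_ β α
  ... | yes _ = +-cong (sym (*-identityʳ b)) (coeff≈⟨δ⟩ p α)
  ... | no  _ = trans (coeff≈⟨δ⟩ p α) (sym (trans (+-congʳ (zeroʳ b)) (+-identityˡ _)))

  infix 4 _≃_
  _≃_ : ∀ {n} → Pol n → Pol n → Set (c ⊔ ℓ)
  p ≃ q = ∀ φ → ⟨ φ , p ⟩ ≈ ⟨ φ , q ⟩

  ≃⇒≐ : ∀ {n} {p q : Pol n} → p ≃ q → p ≐ q
  ≃⇒≐ {p = p} {q} p≃q α = trans (coeff≈⟨δ⟩ p α) (trans (p≃q (δ α)) (sym (coeff≈⟨δ⟩ q α)))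

  ⟨⟩-- : ∀ {n} (φ : Func n) p → ⟨ φ , -P p ⟩ ≈ - ⟨ φ , p ⟩
  ⟨⟩-- φ p = trans (⟨⟩-· φ (- 1#) p) (-1*x≈-x _)
    where open import Algebra.Properties.Ring ring using (-1*x≈-x)

  ≐⇒≃ : ∀ {n} {p q : Pol n} → p ≐ q → p ≃ q
  ≐⇒≃ {p = p} {q} p≐q φ = x∙y⁻¹≈ε⇒x≈y _ _ (trans (sym (⟨φ,p-q⟩ φ))
    (⟨⟩-vanishing φ (p +P (-P q)) (λ α → trans (coeff≈⟨δ⟩ (p +P (-P q)) α)
      (trans (⟨φ,p-q⟩ (δ α)) (x≈y⇒x∙y⁻¹≈ε
        (trans (sym (coeff≈⟨δ⟩ p α)) (trans (p≐q α) (coeff≈⟨δ⟩ q α))))))))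
    where
    open import Algebra.Properties.AbelianGroup +-abelianGroup using (x∙y⁻¹≈ε⇒x≈y; x≈y⇒x∙y⁻¹≈ε)
    ⟨φ,p-q⟩ : ∀ φ → ⟨ φ , p +P (-P q) ⟩ ≈ ⟨ φ , p ⟩ + - ⟨ φ , q ⟩
    ⟨φ,p-q⟩ φ = trans (⟨⟩-++ φ p (-P q)) (+-congˡ (⟨⟩-- φ q))

  -- Pairing with `h` and `e`

  shift-additive : ∀ {n} (α : Mon n) → Additive (shift α)
  shift-additive α = record { cong = λ p β → p _ ; homo = λ φ ψ β → refl }

  shift-τ-comm : ∀ {n} (α : Mon n) v → Commute (shift α) (τ v)
  shift-τ-comm []      v       φ []      = refl
  shift-τ-comm (a ∷ α) zero    φ (b ∷ β) =
    reflexive (≡.cong (λ x → φ (x ∷ V.zipWith ℕ._+_ α β)) (≡.sym (ℕ.+-suc a b)))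
  shift-τ-comm (a ∷ α) (suc v) φ (b ∷ β) = shift-τ-comm α v (λ γ → φ (a ℕ.+ b ∷ γ)) β

  -- Separating exponent 0 of x₁ from the positive ones gives h_{d+1}(x₁,...) = h_{d+1}(x₂,...) + x₁
  -- h_d(x₁,...).
  prefixMons-suc : ∀ n i d → prefixMons (suc n) (suc i) (suc d) ≡
    map (0 ∷_) (prefixMons n i (suc d)) ++ map (λ α → suc (V.head α) ∷ V.tail α) (prefixMons (suc n) (suc i) d)
  prefixMons-suc n i d = ≡.cong (map (0 ∷_) (prefixMons n i (suc d)) ++_) (begin
    concatMap f (L.applyUpTo suc (suc d))
      ≡⟨ ≡.cong (concatMap f) (L.map-upTo suc (suc d)) ⟨
    concatMap f (map suc (upTo (suc d)))
      ≡⟨ L.concatMap-map f suc (upTo (suc d)) ⟩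
    concatMap (λ a → f (suc a)) (upTo (suc d))
      ≡⟨ L.concatMap-cong (λ a → L.map-∘ (prefixMons n i (d ℕ.∸ a))) (upTo (suc d)) ⟩
    concatMap (λ a → map bump (map (a ∷_) (prefixMons n i (d ℕ.∸ a)))) (upTo (suc d))
      ≡⟨ L.map-concatMap bump (λ a → map (a ∷_) (prefixMons n i (d ℕ.∸ a))) (upTo (suc d)) ⟨
    map bump (prefixMons (suc n) (suc i) d) ∎)
    where
    open ≡.≡-Reasoning
    f : ℕ → List (Mon (suc n))
    f a = map (a ∷_) (prefixMons n i (suc d ℕ.∸ a))
    bump : Mon (suc n) → Mon (suc n)
    bump α = suc (V.head α) ∷ V.tail α

  bump-τ : ∀ {n} (φ : Func (suc n)) → (λ α → φ (suc (V.head α) ∷ V.tail α)) ≋ τ 0 φ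
  bump-τ φ (a ∷ α) = refl

  ⟨⟩-h-suc : ∀ {n} (φ : Func (suc n)) d i → ⟨ φ , h (suc n) (suc d) (suc i) ⟩ ≈
             ⟨ (λ α → φ (0 ∷ α)) , h n (suc d) i ⟩ + ⟨ τ 0 φ , h (suc n) d (suc i) ⟩
  ⟨⟩-h-suc {n} φ d i = begin
    ⟨ φ , sumOfMons (prefixMons (suc n) (suc i) (suc d)) ⟩
      ≈⟨ reflexive (≡.cong (λ ms → ⟨ φ , sumOfMons ms ⟩) (prefixMons-suc n i d)) ⟩
    _ ≈⟨ ⟨⟩-sumOfMons-++ φ (map (0 ∷_) (prefixMons n i (suc d))) _ ⟩
    _ ≈⟨ +-cong (⟨⟩-sumOfMons-map φ (0 ∷_) (prefixMons n i (suc d)))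
                (⟨⟩-sumOfMons-map φ _ (prefixMons (suc n) (suc i) d)) ⟩
    _ ≈⟨ +-congˡ (⟨⟩-cong (bump-τ φ) (h (suc n) d (suc i))) ⟩
    ⟨ (λ α → φ (0 ∷ α)) , h n (suc d) i ⟩ + ⟨ τ 0 φ , h (suc n) d (suc i) ⟩ ∎
    where open SetoidReasoning setoid

  ⟨⟩-e-suc : ∀ {n} (φ : Func (suc n)) m → ⟨ φ , e (suc n) (suc m) ⟩ ≈
             ⟨ (λ α → φ (0 ∷ α)) , e n (suc m) ⟩ + ⟨ (λ α → φ (1 ∷ α)) , e n m ⟩
  ⟨⟩-e-suc {n} φ m = trans (⟨⟩-sumOfMons-++ φ (map (0 ∷_) (squarefreeMons n (suc m))) _)
    (+-cong (⟨⟩-sumOfMons-map φ (0 ∷_) (squarefreeMons n (suc m)))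
            (⟨⟩-sumOfMons-map φ (1 ∷_) (squarefreeMons n m)))

  -- `H` recurses on the last variable and `prefixMons` on the first; this is the recurrence of `H`
  -- at the first variable, and `E-suc` that of `E`.
  H-suc : ∀ {L} i m (φ : Func (suc L)) a α →
          H (suc i) (suc m) φ (a ∷ α) ≈ H i (suc m) (λ β → φ (a ∷ β)) α + H (suc i) m φ (suc a ∷ α)
  H-suc zero    m       φ a α = refl
  H-suc (suc i) zero    φ a α = trans (+-congʳ (H-suc i zero φ a α))
    (solve 3 (λ x y z → (x ⊕ y) ⊕ z ⊜ (x ⊕ z) ⊕ y) refl _ _ _)
    where open CMSolver +-commutativeMonoid using (solve; _⊕_; _⊜_)
  H-suc (suc i) (suc m) φ a α = trans
    (+-cong (H-suc i (suc m) φ a α)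
      (trans (cong (τ-additive i) (H-suc (suc i) m φ a) α) (homo (τ-additive i) _ _ α)))
    (interchange _ _ _ _)

  E-suc : ∀ {L} M m (φ : Func (suc L)) a α →
          E (suc M) (suc m) φ (a ∷ α) ≈ E M (suc m) (λ β → φ (a ∷ β)) α + E M m (λ β → φ (suc a ∷ β)) α
  E-suc zero    zero    φ a α = refl
  E-suc zero    (suc m) φ a α = refl
  E-suc (suc M) zero    φ a α = trans (+-congʳ (E-suc M zero φ a α))
    (solve 3 (λ x y z → (x ⊕ y) ⊕ z ⊜ (x ⊕ z) ⊕ y) refl _ _ _)
    where open CMSolver +-commutativeMonoid using (solve; _⊕_; _⊜_)
  E-suc (suc M) (suc m) φ a α = trans
    (+-cong (E-suc M (suc m) φ a α)
      (trans (cong (τ-additive M) (E-suc M m φ a) α) (homo (τ-additive M) _ _ α)))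
    (interchange _ _ _ _)

  restrict : ∀ {n} K → Func (n ℕ.+ K) → Func n
  restrict K φ α = φ (α V.++ zeros K)

  private
    ⟨⟩-[] : (φ : Func 0) → ⟨ φ , (1# , []) ∷ [] ⟩ ≈ φ []
    ⟨⟩-[] φ = trans (+-identityʳ _) (*-identityˡ _)

  -- Both sides are φ(h_m(x₁,...,x_i)): the operator `H` is evaluated at the monomial 1.
  ⟨⟩-h : ∀ n K i m (φ : Func (n ℕ.+ K)) → i ≤ n → ⟨ restrict K φ , h n m i ⟩ ≈ H i m φ (zeros n V.++ zeros K)
  ⟨⟩-h zero    K zero    zero    φ _ = ⟨⟩-[] (restrict {0} K φ)
  ⟨⟩-h zero    K zero    (suc m) φ _ = refl
  ⟨⟩-h (suc n) K zero    m       φ _ = trans (⟨⟩-sumOfMons-map (restrict K φ) (0 ∷_) (prefixMons n zero m))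
    (trans (⟨⟩-h n K zero m (λ β → φ (0 ∷ β)) z≤n) (reflexive (H₀ m)))
    where
    H₀ : ∀ m → H 0 m (λ β → φ (0 ∷ β)) (zeros n V.++ zeros K) ≡ H 0 m φ (0 ∷ zeros n V.++ zeros K)
    H₀ zero    = ≡.refl
    H₀ (suc m) = ≡.refl
  ⟨⟩-h (suc n) K (suc i) zero    φ (s≤s i≤n) = trans
    (trans (⟨⟩-sumOfMons-++ (restrict K φ) (map (0 ∷_) (prefixMons n i 0)) []) (+-identityʳ _))
    (trans (⟨⟩-sumOfMons-map (restrict K φ) (0 ∷_) (prefixMons n i 0))
      (⟨⟩-h n K i zero (λ β → φ (0 ∷ β)) i≤n))
  ⟨⟩-h (suc n) K (suc i) (suc m) φ (s≤s i≤n) = begin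
    ⟨ restrict K φ , h (suc n) (suc m) (suc i) ⟩
      ≈⟨ ⟨⟩-h-suc (restrict K φ) m i ⟩
    ⟨ restrict K (λ β → φ (0 ∷ β)) , h n (suc m) i ⟩ + ⟨ τ 0 (restrict K φ) , h (suc n) m (suc i) ⟩
      ≈⟨ +-cong (⟨⟩-h n K i (suc m) (λ β → φ (0 ∷ β)) i≤n)
                (trans (⟨⟩-cong (λ { (a ∷ α) → refl }) (h (suc n) m (suc i)))
                       (⟨⟩-h (suc n) K (suc i) m (τ 0 φ) (s≤s i≤n))) ⟩
    H i (suc m) (λ β → φ (0 ∷ β)) ζ + H (suc i) m (τ 0 φ) (0 ∷ ζ)
      ≈⟨ +-congˡ (τ-H-comm 0 (suc i) m φ (0 ∷ ζ)) ⟨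
    H i (suc m) (λ β → φ (0 ∷ β)) ζ + H (suc i) m φ (1 ∷ ζ)
      ≈⟨ H-suc i m φ 0 ζ ⟨
    H (suc i) (suc m) φ (0 ∷ ζ) ∎
    where
    open SetoidReasoning setoid
    ζ = zeros n V.++ zeros K

  ⟨⟩-e : ∀ n K m (φ : Func (n ℕ.+ K)) → ⟨ restrict K φ , e n m ⟩ ≈ E n m φ (zeros n V.++ zeros K)
  ⟨⟩-e zero    K zero    φ = ⟨⟩-[] (restrict {0} K φ)
  ⟨⟩-e zero    K (suc m) φ = refl
  ⟨⟩-e (suc n) K zero    φ = trans (⟨⟩-sumOfMons-map (restrict K φ) (0 ∷_) (squarefreeMons n 0))
    (⟨⟩-e n K zero (λ β → φ (0 ∷ β)))
  ⟨⟩-e (suc n) K (suc m) φ = trans (⟨⟩-e-suc (restrict K φ) m)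
    (trans (+-cong (⟨⟩-e n K (suc m) (λ β → φ (0 ∷ β))) (⟨⟩-e n K m (λ β → φ (1 ∷ β))))
      (sym (E-suc n m φ 0 _)))

  shift-restrict : ∀ {n} K (φ : Func (n ℕ.+ K)) α → shift α (restrict K φ) ≋ restrict K (shift (α V.++ zeros K) φ)
  shift-restrict {n} K φ α β = reflexive (≡.cong φ (≡.sym (go α β)))
    where
    go : ∀ {n} (α β : Mon n) → V.zipWith ℕ._+_ (α V.++ zeros K) (β V.++ zeros K) ≡ V.zipWith ℕ._+_ α β V.++ zeros K
    go []      []      = V.zipWith-replicate ℕ._+_ 0 0
    go (a ∷ α) (b ∷ β) = ≡.cong (a ℕ.+ b ∷_) (go α β)

  ⟨⟩-h-vanishes : ∀ n K i m (φ : Func (n ℕ.+ K)) → i ≤ n → H i m φ ≋ 𝟘 →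
                  ∀ α → ⟨ shift α (restrict K φ) , h n m i ⟩ ≈ 0#
  ⟨⟩-h-vanishes n K i m φ i≤n killed α = trans (⟨⟩-cong (shift-restrict K φ α) (h n m i))
    (trans (⟨⟩-h n K i m (shift α⁺ φ) i≤n)
      (trans (sym (H-comm₀ (shift-additive α⁺) i (λ v _ → shift-τ-comm α⁺ v) m φ _))
        (kills (shift-additive α⁺) killed _)))
    where α⁺ = α V.++ zeros K

  ⟨⟩-e-vanishes : ∀ n K m (φ : Func (n ℕ.+ K)) → E n m φ ≋ 𝟘 →
                  ∀ α → ⟨ shift α (restrict K φ) , e n m ⟩ ≈ 0#
  ⟨⟩-e-vanishes n K m φ killed α = trans (⟨⟩-cong (shift-restrict K φ α) (e n m))
    (trans (⟨⟩-e n K m (shift α⁺ φ))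
      (trans (sym (E-comm₀ (shift-additive α⁺) n (λ v _ → shift-τ-comm α⁺ v) m φ _))
        (kills (shift-additive α⁺) killed _)))
    where α⁺ = α V.++ zeros K

  -- Functionals vanishing on the ideal, and independence

  ⟨⟩-sumP-* : ∀ {n} (φ : Func n) gs (cs : Vec (Pol n) (L.length gs)) →
              AllL (λ g → ∀ α → ⟨ shift α φ , g ⟩ ≈ 0#) gs →
              ⟨ φ , sumP (V.toList (V.zipWith _*P_ cs (V.fromList gs))) ⟩ ≈ 0#
  ⟨⟩-sumP-* φ []       []       []             = refl
  ⟨⟩-sumP-* φ (g ∷ gs) (q ∷ cs) (g≈0 ∷ gs≈0) = trans (⟨⟩-++ φ (q *P g) _)
    (trans (+-cong (trans (⟨⟩-* φ q g) (trans (⟨⟩-cong g≈0 q) (vanish q))) (⟨⟩-sumP-* φ gs cs gs≈0))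
           (+-identityˡ 0#))
    where
    vanish : ∀ p → ⟨ 𝟘 , p ⟩ ≈ 0#
    vanish []      = refl
    vanish (x ∷ p) = trans (+-cong (zeroʳ _) (vanish p)) (+-identityˡ 0#)

  ⟨⟩-ideal : ∀ {n} (φ : Func n) gs p → AllL (λ g → ∀ α → ⟨ shift α φ , g ⟩ ≈ 0#) gs →
             InIdeal gs p → ⟨ φ , p ⟩ ≈ 0#
  ⟨⟩-ideal φ gs p gs≈0 (cs , p≐) = trans (≐⇒≃ {p = p} {q = sumP (V.toList (V.zipWith _*P_ cs (V.fromList gs)))} p≐ φ) (⟨⟩-sumP-* φ gs cs gs≈0)

  coefficientFunctional : ∀ {n} → ℕ → Mon n → Func n
  coefficientFunctional k as = restrict k (Λ 0 as ε)

  coefficientFunctional-ideal : ∀ n k (as : Mon n) → k < n → Admissible 0 (suc k) as → ∀ p →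
                                InIdeal (gensJ n (suc k)) p → ⟨ coefficientFunctional (suc k) as , p ⟩ ≈ 0#
  coefficientFunctional-ideal n k as k<n adm p = ⟨⟩-ideal (coefficientFunctional (suc k) as) (gensJ n (suc k)) p
    (All.++⁺ (All.map⁺ (All.applyUpTo⁺₁ (λ i → i) n λ {i} i<n →
               ⟨⟩-h-vanishes n (suc k) (suc i) (suc k) (Λ 0 as ε) i<n
                 (≡.subst (λ i → H (suc i) (suc k) (Λ 0 as ε) ≋ 𝟘) (ℕ.+-identityʳ i)
                   (Λ-kills-H 0 k as bounded (λ M _ → ε-KillH M) i i<n))))
             (All.map⁺ (All.applyUpTo⁺₁ (λ t → t) (suc k) λ {t} t<1+k →
               ⟨⟩-e-vanishes n (suc k) (n ℕ.∸ t) (Λ 0 as ε)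
                 (≡.subst (λ M → E M (n ℕ.∸ t) (Λ 0 as (ε {n ℕ.+ suc k})) ≋ 𝟘) (ℕ.+-identityʳ n)
                   -- The start is s = k + 1 and threshold 0, because `ε` kills every e_m of
                   -- positive degree. For m = n - t the bound to check becomes n < (n - t) + k + 1.
                   (Λ-kills-E {L = n ℕ.+ suc k} 0 0 (suc k) 0 as adm (ε-KillE (suc k ℕ.+ 0)) (n ℕ.∸ t) (n<n∸t+1+k t<1+k))))))
    where
    bounded = ≡.subst (λ k → VAll (_< k) as) (ℕ.+-identityʳ (suc k)) (Admissible⇒< 0 (suc k) as adm)
    n<n∸t+1+k : ∀ {t} → t < suc k → n < n ℕ.∸ t ℕ.+ suc k
    n<n∸t+1+k {t} t<1+k = ℕ.≤-<-trans (ℕ.m≤n+m∸n n t)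
      (≡.subst (_< n ℕ.∸ t ℕ.+ suc k) (ℕ.+-comm (n ℕ.∸ t) t) (ℕ.+-monoʳ-< (n ℕ.∸ t) t<1+k))

  monomial : ∀ {n} → Mon n → Pol n
  monomial α = (1# , α) ∷ []

  ⟨⟩-monomial : ∀ {n} (φ : Func n) α → ⟨ φ , monomial α ⟩ ≈ φ α
  ⟨⟩-monomial φ α = trans (+-identityʳ _) (*-identityˡ _)

  basis : ∀ {n} (bs : List (Mon n)) → Fin (L.length bs) → Pol n
  basis bs i = monomial (L.lookup bs i)

  ⟨⟩-linComb-∷ : ∀ {n} (φ : Func n) b bs (a : Fin (suc (L.length bs)) → Carrier) →
    ⟨ φ , linComb a (basis (b ∷ bs)) ⟩ ≈
    a Fin.zero * φ b + ⟨ φ , linComb (λ i → a (Fin.suc i)) (basis bs) ⟩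
  ⟨⟩-linComb-∷ φ b bs a = +-congʳ (*-congʳ (*-identityʳ (a Fin.zero)))

  ⟨⟩-linComb-0 : ∀ {n} (φ : Func n) bs (a : Fin (L.length bs) → Carrier) → AllL (λ b → φ b ≈ 0#) bs →
                 ⟨ φ , linComb a (basis bs) ⟩ ≈ 0#
  ⟨⟩-linComb-0 φ []       a []           = refl
  ⟨⟩-linComb-0 φ (b ∷ bs) a (φb ∷ φbs) = trans (⟨⟩-linComb-∷ φ b bs a)
    (trans (+-cong (trans (*-congˡ φb) (zeroʳ _)) (⟨⟩-linComb-0 φ bs _ φbs)) (+-identityˡ 0#))

  -- Forward substitution: λ′ b ignores all later monomials, so pairing with the functional of the
  -- first one isolates its coefficient, which then drops out of the other pairings.
  triangular-independence : ∀ {n} (λ′ : Mon n → Func n) bs → AllL (λ b → λ′ b b ≈ 1#) bs →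
    AllPairs (λ b b′ → λ′ b b′ ≈ 0#) bs → ∀ a →
    AllL (λ b → ⟨ λ′ b , linComb a (basis bs) ⟩ ≈ 0#) bs → ∀ i → a i ≈ 0#
  triangular-independence λ′ (b ∷ bs) (diag ∷ diags) (above ∷ aboves) a (zero₀ ∷ zeros₀) = go
    where
    open SetoidReasoning setoid
    tail = λ i → a (Fin.suc i)
    a₀≈0 : a Fin.zero ≈ 0#
    a₀≈0 = begin
      a Fin.zero                                                     ≈⟨ *-identityʳ _ ⟨
      a Fin.zero * 1#                                                ≈⟨ *-congˡ diag ⟨
      a Fin.zero * λ′ b b                                            ≈⟨ +-identityʳ _ ⟨
      a Fin.zero * λ′ b b + 0#                                       ≈⟨ +-congˡ (⟨⟩-linComb-0 (λ′ b) bs tail above) ⟨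
      a Fin.zero * λ′ b b + ⟨ λ′ b , linComb tail (basis bs) ⟩       ≈⟨ ⟨⟩-linComb-∷ (λ′ b) b bs a ⟨
      ⟨ λ′ b , linComb a (basis (b ∷ bs)) ⟩                          ≈⟨ zero₀ ⟩
      0# ∎
    drop₀ : ∀ {b′} → ⟨ λ′ b′ , linComb a (basis (b ∷ bs)) ⟩ ≈ 0# → ⟨ λ′ b′ , linComb tail (basis bs) ⟩ ≈ 0#
    drop₀ {b′} z = trans (sym (+-identityˡ _))
      (trans (+-congʳ (sym (trans (*-congʳ a₀≈0) (zeroˡ _)))) (trans (sym (⟨⟩-linComb-∷ (λ′ b′) b bs a)) z))
    go : ∀ i → a i ≈ 0#
    go Fin.zero    = a₀≈0
    go (Fin.suc i) = triangular-independence λ′ bs diags aboves tail (All.map drop₀ zeros₀) i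

  admissible-independent : ∀ n k (bs : List (Mon n)) → k < n → AllL (Admissible 0 (suc k)) bs →
    AllPairs _<ₗ_ bs → ∀ a → InIdeal (gensJ n (suc k)) (linComb a (basis bs)) → ∀ i → a i ≈ 0#
  admissible-independent n k bs k<n adms sorted a p∈J = triangular-independence (coefficientFunctional (suc k)) bs
    (All.map (λ {b} adm → Λ-diagonal (suc k) b (bounded b adm)) adms)
    (above bs adms sorted) a
    (All.map (λ {b} adm → coefficientFunctional-ideal n k b k<n adm (linComb a (basis bs)) p∈J) adms)
    where
    bounded : ∀ b → Admissible 0 (suc k) b → VAll (_< suc k) b
    bounded b adm = ≡.subst (λ k → VAll (_< k) b) (ℕ.+-identityʳ (suc k)) (Admissible⇒< 0 (suc k) b adm)
    above : ∀ bs → AllL (Admissible 0 (suc k)) bs → AllPairs _<ₗ_ bs →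
            AllPairs (λ b b′ → coefficientFunctional (suc k) b b′ ≈ 0#) bs
    above []       []           []             = []
    above (b ∷ bs) (adm ∷ adms) (b<bs ∷ sorted) =
      All.map (λ {b′} b<b′ → Λ-above (suc k) b b′ (bounded b adm) b<b′) b<bs ∷ above bs adms sorted

-- The admissible monomials span

module Spanning {c ℓ : Level} (F : Field c ℓ) where
  open Field F hiding (zero)
  open Poly F
  open DividedDifferences commutativeRing
  open Pairing F

  -- Red κ r s d p: p is, up to degree-d elements of the ideal generated by
  -- h_{κ+1}(x₁,…,x_i) for i ≤ N and e_m(x₁,…,x_N) for m > N − s, a linear
  -- combination of admissible monomials of degree d.
  data Red {N : ℕ} (κ r s d : ℕ) : Pol N → Set (c ⊔ ℓ) where
    zero     : Red κ r s d []
    add      : ∀ {p q} → Red κ r s d p → Red κ r s d q → Red κ r s d (p +P q)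
    scale    : ∀ a {p} → Red κ r s d p → Red κ r s d (a ·P p)
    resp     : ∀ {p q} → p ≃ q → Red κ r s d p → Red κ r s d q
    standard : ∀ {α} → Admissible r s α → deg α ≡ d → Red κ r s d (monomial α)
    h-mult   : ∀ γ i → i < N → deg γ ℕ.+ suc κ ≡ d → Red κ r s d (monomial γ *P h N (suc κ) (suc i))
    e-mult   : ∀ γ m → N < m ℕ.+ s → deg γ ℕ.+ m ≡ d → Red κ r s d (monomial γ *P e N m)

  ⟨⟩-monomial-* : ∀ {n} (φ : Func n) γ p → ⟨ φ , monomial γ *P p ⟩ ≈ ⟨ shift γ φ , p ⟩
  ⟨⟩-monomial-* φ γ p = trans (⟨⟩-* φ (monomial γ) p) (⟨⟩-monomial (λ α → ⟨ shift α φ , p ⟩) γ)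

  -- The shape in which every exchange relation is applied: p is a multiple of a generator in all
  -- variables, t is already reduced, and q = p - t.
  Red-sub : ∀ {N κ r s d} {p q t : Pol N} → (∀ φ → ⟨ φ , p ⟩ ≈ ⟨ φ , q ⟩ + ⟨ φ , t ⟩) →
            Red κ r s d p → Red κ r s d t → Red κ r s d q
  Red-sub {p = p} {q} {t} p≈q+t redp redt = resp p-t≃q (add redp (scale (- 1#) redt))
    where
    open SetoidReasoning setoid
    p-t≃q : (p +P (-P t)) ≃ q
    p-t≃q φ = begin
      ⟨ φ , p +P (-P t) ⟩                       ≈⟨ ⟨⟩-++ φ p (-P t) ⟩
      ⟨ φ , p ⟩ + ⟨ φ , -P t ⟩                  ≈⟨ +-cong (p≈q+t φ) (⟨⟩-- φ t) ⟩
      (⟨ φ , q ⟩ + ⟨ φ , t ⟩) + - ⟨ φ , t ⟩     ≈⟨ +-assoc _ _ _ ⟩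
      ⟨ φ , q ⟩ + (⟨ φ , t ⟩ + - ⟨ φ , t ⟩)     ≈⟨ +-congˡ (-‿inverseʳ _) ⟩
      ⟨ φ , q ⟩ + 0#                            ≈⟨ +-identityʳ _ ⟩
      ⟨ φ , q ⟩ ∎

  Red-terms : ∀ {N κ r s d} γ (ms : List (Mon N)) →
              AllL (λ α → Red κ r s d (monomial (V.zipWith ℕ._+_ γ α))) ms →
              Red κ r s d (monomial γ *P sumOfMons ms)
  Red-terms γ []       []           = zero
  Red-terms γ (α ∷ ms) (red ∷ reds) = resp
    (λ φ → trans (+-congˡ (⟨⟩-monomial-* φ γ (sumOfMons ms)))
                 (sym (⟨⟩-monomial-* φ γ (sumOfMons (α ∷ ms)))))
    (add red (Red-terms γ ms reds))

  deg-zipWith : ∀ {n} (α β : Mon n) → deg (V.zipWith ℕ._+_ α β) ≡ deg α ℕ.+ deg β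
  deg-zipWith []      []      = ≡.refl
  deg-zipWith (a ∷ α) (b ∷ β) = ≡.trans (≡.cong (a ℕ.+ b ℕ.+_) (deg-zipWith α β))
    (solve 4 (λ a b x y → (a :+ b) :+ (x :+ y) := (a :+ x) :+ (b :+ y)) ≡.refl a b (deg α) (deg β))
    where open +-*-Solver

  deg-prefixMons : ∀ n i d → AllL (λ α → deg α ≡ d) (prefixMons n i d)
  deg-prefixMons zero    i       zero    = ≡.refl ∷ []
  deg-prefixMons zero    i       (suc d) = []
  deg-prefixMons (suc n) zero    d       = All.map⁺ (deg-prefixMons n zero d)
  deg-prefixMons (suc n) (suc i) d       = All.concat⁺ (All.map⁺ (All.applyUpTo⁺₁ (λ a → a) (suc d)
    λ {a} a≤d → All.map⁺ (All.map (λ {α} degα → ≡.trans (≡.cong (a ℕ.+_) degα) (ℕ.m+[n∸m]≡n (ℕ.≤-pred a≤d)))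
                                  (deg-prefixMons n i (d ℕ.∸ a)))))

  deg-squarefreeMons : ∀ n j → AllL (λ α → deg α ≡ j) (squarefreeMons n j)
  deg-squarefreeMons zero    zero    = ≡.refl ∷ []
  deg-squarefreeMons zero    (suc j) = []
  deg-squarefreeMons (suc n) zero    = All.map⁺ (deg-squarefreeMons n zero)
  deg-squarefreeMons (suc n) (suc j) = All.++⁺ (All.map⁺ (deg-squarefreeMons n (suc j)))
    (All.map⁺ (All.map (≡.cong suc) (deg-squarefreeMons n j)))

  squarefreeMons-[] : ∀ n j → n < j → squarefreeMons n j ≡ []
  squarefreeMons-[] zero    (suc j) _         = ≡.refl
  squarefreeMons-[] (suc n) (suc j) (s≤s n<j) = ≡.cong₂ (λ ms ms′ → map (0 ∷_) ms ++ map (1 ∷_) ms′)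
    (squarefreeMons-[] n (suc j) (ℕ.m<n⇒m<1+n n<j)) (squarefreeMons-[] n j n<j)

  monomial-*-e-vanishes : ∀ {n} (γ : Mon n) m → n < m → (monomial γ *P e n m) ≃ []
  monomial-*-e-vanishes {n} γ m n<m φ = trans (⟨⟩-monomial-* φ γ (e n m))
    (reflexive (≡.cong (λ ms → ⟨ shift γ φ , sumOfMons ms ⟩) (squarefreeMons-[] n m n<m)))

  ⟨⟩-h₀ : ∀ {n} (φ : Func n) → ⟨ φ , h n 0 0 ⟩ ≈ φ (zeros n)
  ⟨⟩-h₀ {zero}  φ = ⟨⟩-monomial φ []
  ⟨⟩-h₀ {suc n} φ = trans (⟨⟩-sumOfMons-map φ (0 ∷_) (prefixMons n 0 0)) (⟨⟩-h₀ (λ α → φ (0 ∷ α)))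

  ⟨⟩-h₀-suc : ∀ {n} (φ : Func n) d → ⟨ φ , h n (suc d) 0 ⟩ ≈ 0#
  ⟨⟩-h₀-suc {zero}  φ d = refl
  ⟨⟩-h₀-suc {suc n} φ d = trans (⟨⟩-sumOfMons-map φ (0 ∷_) (prefixMons n 0 (suc d)))
    (⟨⟩-h₀-suc (λ α → φ (0 ∷ α)) d)

  ⟨⟩-h₁ : ∀ {n} (φ : Func (suc n)) d → ⟨ φ , h (suc n) d 1 ⟩ ≈ φ (d ∷ zeros n)
  ⟨⟩-h₁ {n} φ zero    = trans (⟨⟩-sumOfMons-++ φ (map (0 ∷_) (prefixMons n 0 0)) [])
    (trans (+-identityʳ _) (trans (⟨⟩-sumOfMons-map φ (0 ∷_) (prefixMons n 0 0)) (⟨⟩-h₀ (λ α → φ (0 ∷ α)))))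
  ⟨⟩-h₁ {n} φ (suc d) = trans (⟨⟩-h-suc φ d 0)
    (trans (+-cong (⟨⟩-h₀-suc (λ α → φ (0 ∷ α)) d) (⟨⟩-h₁ (τ 0 φ) d)) (+-identityˡ _))

  -- Multiplication by a power of a new first variable.
  raise : ∀ {n} → ℕ → Pol n → Pol (suc n)
  raise j = map λ (a , α) → a , j ∷ α

  ⟨⟩-raise : ∀ {n} (φ : Func (suc n)) j p → ⟨ φ , raise j p ⟩ ≈ ⟨ (λ α → φ (j ∷ α)) , p ⟩
  ⟨⟩-raise φ j []            = refl
  ⟨⟩-raise φ j ((a , α) ∷ p) = +-congˡ (⟨⟩-raise φ j p)

  shift-∷ : ∀ {n} (φ : Func (suc n)) j (γ : Mon n) →
            (λ α → shift (j ∷ γ) φ (0 ∷ α)) ≋ shift γ (λ α → φ (j ∷ α))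
  shift-∷ φ j γ α = reflexive (≡.cong (λ x → φ (x ∷ V.zipWith ℕ._+_ γ α)) (ℕ.+-identityʳ j))

  shift-suc-∷ : ∀ {n} (φ : Func (suc n)) j (γ : Mon n) → τ 0 (shift (j ∷ γ) φ) ≋ shift (suc j ∷ γ) φ
  shift-suc-∷ φ j γ (a ∷ α) = reflexive (≡.cong (λ x → φ (x ∷ V.zipWith ℕ._+_ γ α)) (ℕ.+-suc j a))

  shift-1-∷ : ∀ {n} (φ : Func (suc n)) j (γ : Mon n) →
              (λ α → shift (j ∷ γ) φ (1 ∷ α)) ≋ shift γ (λ α → φ (suc j ∷ α))
  shift-1-∷ φ j γ α = reflexive (≡.cong (λ x → φ (x ∷ V.zipWith ℕ._+_ γ α)) (ℕ.+-comm j 1))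

  ⟨⟩-raise-* : ∀ {n} (φ : Func (suc n)) j γ p →
               ⟨ φ , raise j (monomial γ *P p) ⟩ ≈ ⟨ shift γ (λ α → φ (j ∷ α)) , p ⟩
  ⟨⟩-raise-* φ j γ p = trans (⟨⟩-raise φ j (monomial γ *P p)) (⟨⟩-monomial-* _ γ p)

  -- Modulo h in all variables, a relation in x₂,x₃,... times x₁^j is traded for terms with a higher
  -- power of x₁.
  raise-h : ∀ {n} j (γ : Mon n) d i (φ : Func (suc n)) →
    ⟨ φ , monomial (j ∷ γ) *P h (suc n) (suc d) (suc i) ⟩ ≈
    ⟨ φ , raise j (monomial γ *P h n (suc d) i) ⟩ + ⟨ φ , monomial (suc j ∷ γ) *P h (suc n) d (suc i) ⟩
  raise-h {n} j γ d i φ = begin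
    ⟨ φ , monomial (j ∷ γ) *P h (suc n) (suc d) (suc i) ⟩
      ≈⟨ ⟨⟩-monomial-* φ (j ∷ γ) (h (suc n) (suc d) (suc i)) ⟩
    ⟨ shift (j ∷ γ) φ , h (suc n) (suc d) (suc i) ⟩
      ≈⟨ ⟨⟩-h-suc (shift (j ∷ γ) φ) d i ⟩
    _ ≈⟨ +-cong (⟨⟩-cong (shift-∷ φ j γ) (h n (suc d) i)) (⟨⟩-cong (shift-suc-∷ φ j γ) (h (suc n) d (suc i))) ⟩
    _ ≈⟨ +-cong (⟨⟩-raise-* φ j γ (h n (suc d) i)) (⟨⟩-monomial-* φ (suc j ∷ γ) (h (suc n) d (suc i))) ⟨
    _ ∎
    where open SetoidReasoning setoid

  raise-e : ∀ {n} j (γ : Mon n) m (φ : Func (suc n)) →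
    ⟨ φ , monomial (j ∷ γ) *P e (suc n) (suc m) ⟩ ≈
    ⟨ φ , raise j (monomial γ *P e n (suc m)) ⟩ + ⟨ φ , raise (suc j) (monomial γ *P e n m) ⟩
  raise-e {n} j γ m φ = begin
    ⟨ φ , monomial (j ∷ γ) *P e (suc n) (suc m) ⟩
      ≈⟨ ⟨⟩-monomial-* φ (j ∷ γ) (e (suc n) (suc m)) ⟩
    ⟨ shift (j ∷ γ) φ , e (suc n) (suc m) ⟩
      ≈⟨ ⟨⟩-e-suc (shift (j ∷ γ) φ) m ⟩
    _ ≈⟨ +-cong (⟨⟩-cong (shift-∷ φ j γ) (e n (suc m))) (⟨⟩-cong (shift-1-∷ φ j γ) (e n m)) ⟩
    _ ≈⟨ +-cong (⟨⟩-raise-* φ j γ (e n (suc m))) (⟨⟩-raise-* φ (suc j) γ (e n m)) ⟨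
    _ ∎
    where open SetoidReasoning setoid

  raise-e₀ : ∀ {n} j (γ : Mon n) → (monomial (j ∷ γ) *P e (suc n) 0) ≃ raise j (monomial γ *P e n 0)
  raise-e₀ {n} j γ φ = trans (⟨⟩-monomial-* φ (j ∷ γ) (e (suc n) 0))
    (trans (⟨⟩-sumOfMons-map (shift (j ∷ γ) φ) (0 ∷_) (squarefreeMons n 0))
      (trans (⟨⟩-cong (shift-∷ φ j γ) (e n 0)) (sym (⟨⟩-raise-* φ j γ (e n 0)))))

  -- x₁ e_m(x₂,…) = e_{m+1}(x₁,x₂,…) − e_{m+1}(x₂,…) trades powers of x₁ for
  -- a larger m, until e_m(x₂,…) = 0.
  Red-raise-e : ∀ {n κ r s d} i m (γ : Mon n) → n < m ℕ.+ s → n < i ℕ.+ m → i ℕ.+ (deg γ ℕ.+ m) ≡ d →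
                Red κ r s d (raise i (monomial γ *P e n m))
  Red-raise-e {n} zero m γ n<m+s n<m deg≡ = resp
    (λ φ → sym (trans (⟨⟩-raise φ 0 (monomial γ *P e n m)) (monomial-*-e-vanishes γ m n<m (λ α → φ (0 ∷ α)))))
    zero
  Red-raise-e {n} {s = s} {d} (suc i) m γ n<m+s n<i+m deg≡ = Red-sub
    (λ φ → trans (raise-e i γ m φ) (+-comm _ _))
    (e-mult (i ∷ γ) (suc m) (s≤s n<m+s)
      (≡.trans (solve 3 (λ i x m → (i :+ x) :+ (con 1 :+ m) := con 1 :+ (i :+ (x :+ m))) ≡.refl i (deg γ) m) deg≡))
    (Red-raise-e i (suc m) γ (ℕ.m<n⇒m<1+n n<m+s) (≡.subst (n <_) (≡.sym (ℕ.+-suc i m)) n<i+m)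
      (≡.trans (solve 3 (λ i x m → i :+ (x :+ (con 1 :+ m)) := con 1 :+ (i :+ (x :+ m))) ≡.refl i (deg γ) m) deg≡))
    where open +-*-Solver

  -- The hypothesis of the downward induction on the exponent of x₁. It absorbs the error terms
  -- divisible by x₁^{j+1}.
  HigherReduce : ∀ {n} (κ r s j : ℕ) → Set (c ⊔ ℓ)
  HigherReduce {n} κ r s j = ∀ j′ (γ : Mon n) → j < j′ → Red κ r s (deg (j′ ∷ γ)) (monomial (j′ ∷ γ))

  Red-higher : ∀ {n κ r s j d} → HigherReduce {n} κ r s j → ∀ {j′} γ → j < j′ →
               deg (j′ ∷ γ) ≡ d → Red κ r s d (monomial (j′ ∷ γ))
  Red-higher {κ = κ} {r} {s} higher {j′} γ j<j′ deg≡ =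
    ≡.subst (λ d → Red κ r s d (monomial (j′ ∷ γ))) deg≡ (higher j′ γ j<j′)

  -- In e_m(x₂,...) = e_m(x₁,x₂,...) - x₁ e_{m-1}(x₂,...) the first term is a generator, as the
  -- number of variables and s both grow by one; the second has a higher power of x₁.
  Red-raise-e-higher : ∀ {n κ r s d} j m (γ : Mon n) → HigherReduce {n} κ r (suc s) j → n < m ℕ.+ s →
                       j ℕ.+ (deg γ ℕ.+ m) ≡ d → Red κ r (suc s) d (raise j (monomial γ *P e n m))
  Red-raise-e-higher {s = s} j zero    γ higher n<m+s deg≡ = resp (raise-e₀ j γ)
    (e-mult (j ∷ γ) 0 (s≤s n<m+s) (≡.trans (ℕ.+-assoc j (deg γ) 0) deg≡))
  Red-raise-e-higher {n} {s = s} {d} j (suc m) γ higher n<m+s deg≡ = Red-sub {t = raise (suc j) (monomial γ *P e n m)} (raise-e j γ m)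
    (e-mult (j ∷ γ) (suc m) (≡.subst (suc n <_) (≡.cong suc (≡.sym (ℕ.+-suc m s))) (s≤s n<m+s))
      (≡.trans (ℕ.+-assoc j (deg γ) (suc m)) deg≡))
    (resp (λ φ → trans (⟨⟩-monomial-* φ (suc j ∷ γ) (sumOfMons (map (0 ∷_) (squarefreeMons n m))))
                   (trans (⟨⟩-sumOfMons-map _ (0 ∷_) (squarefreeMons n m))
                     (trans (⟨⟩-cong (shift-∷ φ (suc j) γ) (e n m)) (sym (⟨⟩-raise-* φ (suc j) γ (e n m))))))
      (Red-terms (suc j ∷ γ) (map (0 ∷_) (squarefreeMons n m))
        (All.map⁺ (All.map (λ {α} degα → Red-higher higher (V.zipWith ℕ._+_ γ α) (ℕ.m≤m+n (suc j) 0) (total α degα))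
                           (deg-squarefreeMons n m)))))
    where
    open +-*-Solver
    total : ∀ α → deg α ≡ m → suc j ℕ.+ 0 ℕ.+ deg (V.zipWith ℕ._+_ γ α) ≡ d
    total α degα = ≡.trans (≡.cong (suc j ℕ.+ 0 ℕ.+_) (≡.trans (deg-zipWith γ α) (≡.cong (deg γ ℕ.+_) degα)))
      (≡.trans (solve 3 (λ j x m → ((con 1 :+ j) :+ con 0) :+ (x :+ m) := j :+ (x :+ (con 1 :+ m))) ≡.refl j (deg γ) m) deg≡)

  -- Multiplication by x₁^j carries reductions in the later variables to reductions in all of them.
  -- The e-generators need different arguments for j < s and j ≥ s, so their case is a parameter.
  Red-raise : ∀ {n κ r s r′ s′} j → HigherReduce {n} κ r s j →
    (∀ {α : Mon n} → Admissible r′ s′ α → Admissible r s (j ∷ α)) →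
    (∀ m γ d → n < m ℕ.+ s′ → j ℕ.+ (deg γ ℕ.+ m) ≡ d → Red κ r s d (raise j (monomial γ *P e n m))) →
    ∀ {d} {p : Pol n} → Red κ r′ s′ d p → Red κ r s (j ℕ.+ d) (raise j p)
  Red-raise {n} {κ} {r} {s} {r′} {s′} j higher adm e-case = go
    where
    go : ∀ {d} {p : Pol n} → Red κ r′ s′ d p → Red κ r s (j ℕ.+ d) (raise j p)
    go zero = zero
    go (add {p} {q} redp redq) = resp
      (λ φ → reflexive (≡.cong ⟨ φ ,_⟩ (≡.sym (L.map-++ _ p q)))) (add (go redp) (go redq))
    go (scale a {p} red) = resp
      (λ φ → trans (⟨⟩-· φ a (raise j p))
               (trans (*-congˡ (⟨⟩-raise φ j p))
                 (sym (trans (⟨⟩-raise φ j (a ·P p)) (⟨⟩-· _ a p)))))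
      (scale a (go red))
    go (resp {p} {q} p≃q red) = resp
      (λ φ → trans (⟨⟩-raise φ j p) (trans (p≃q _) (sym (⟨⟩-raise φ j q)))) (go red)
    go (standard α-adm deg≡) = standard (adm α-adm) (≡.cong (j ℕ.+_) deg≡)
    go (e-mult γ m n<m+s′ deg≡) = e-case m γ _ n<m+s′ (≡.cong (j ℕ.+_) deg≡)
    go {d} (h-mult γ i i<n deg≡) = Red-sub (raise-h j γ κ (suc i))
      (h-mult (j ∷ γ) (suc i) (s≤s i<n) (≡.trans (ℕ.+-assoc j (deg γ) (suc κ)) (≡.cong (j ℕ.+_) deg≡)))
      (Red-terms (suc j ∷ γ) (prefixMons (suc n) (suc (suc i)) κ)
        (All.map (λ { {a ∷ α} degα → Red-higher higher (V.zipWith ℕ._+_ γ α) (s≤s (ℕ.m≤m+n j a)) (total a α degα) })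
                 (deg-prefixMons (suc n) (suc (suc i)) κ)))
      where
      open +-*-Solver
      total : ∀ a α → a ℕ.+ deg α ≡ κ → suc j ℕ.+ a ℕ.+ deg (V.zipWith ℕ._+_ γ α) ≡ j ℕ.+ d
      total a α degα = ≡.trans (≡.cong (suc j ℕ.+ a ℕ.+_) (deg-zipWith γ α))
        (≡.trans (solve 4 (λ j a x y → ((con 1 :+ j) :+ a) :+ (x :+ y) := j :+ (x :+ (con 1 :+ (a :+ y)))) ≡.refl j a (deg γ) (deg α))
          (≡.cong (j ℕ.+_) (≡.trans (≡.cong (λ y → deg γ ℕ.+ suc y) degα) deg≡)))

  -- The generator h_{κ+1}(x₁) is x₁^{κ+1}.
  Red-high-power : ∀ {n κ r s} j (γ : Mon n) → suc κ ≤ j → Red κ r s (deg (j ∷ γ)) (monomial (j ∷ γ))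
  Red-high-power {n} {κ} j γ κ<j = resp
    (λ φ → trans (⟨⟩-monomial-* φ (j ℕ.∸ suc κ ∷ γ) (h (suc n) (suc κ) 1))
             (trans (⟨⟩-h₁ (shift (j ℕ.∸ suc κ ∷ γ) φ) (suc κ))
               (trans (reflexive (≡.cong₂ (λ a α → φ (a ∷ α)) (ℕ.m∸n+n≡m κ<j) (V.zipWith-identityʳ ℕ.+-identityʳ γ)))
                      (sym (⟨⟩-monomial φ (j ∷ γ))))))
    (h-mult (j ℕ.∸ suc κ ∷ γ) 0 (s≤s z≤n)
      (≡.trans (solve 3 (λ x y z → (x :+ y) :+ z := (x :+ z) :+ y) ≡.refl (j ℕ.∸ suc κ) (deg γ) (suc κ))
               (≡.cong (ℕ._+ deg γ) (ℕ.m∸n+n≡m κ<j))))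
    where open +-*-Solver

  Red-monomial : ∀ {n} κ r s → s ℕ.+ r ≡ suc κ → (γ : Mon n) → Red κ r s (deg γ) (monomial γ)
  Red-monomial κ r zero    s+r≡k [] = standard ≡.refl ≡.refl
  -- With no variables left and s > 0, the generators include e₀ = 1.
  Red-monomial κ r (suc s) s+r≡k [] = resp
    (λ φ → trans (⟨⟩-monomial-* φ [] (e 0 0)) refl) (e-mult [] 0 (s≤s z≤n) ≡.refl)
  Red-monomial {suc n} κ r s s+r≡k (j₀ ∷ γ₀) = go (suc κ) j₀ γ₀ (ℕ.m≤n+m (suc κ) j₀)
    where
    -- Downward induction on the exponent j; t bounds its distance to κ + 1.
    go : ∀ t j γ → suc κ ≤ j ℕ.+ t → Red κ r s (deg (j ∷ γ)) (monomial (j ∷ γ))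
    go t j γ k≤j+t with suc κ ℕ.≤? j
    go t       j γ k≤j+t | yes κ<j = Red-high-power j γ κ<j
    go zero    j γ k≤j+t | no  κ≮j = contradiction (≡.subst (suc κ ≤_) (ℕ.+-identityʳ j) k≤j+t) κ≮j
    go (suc t) j γ k≤j+t | no  κ≮j = step s s+r≡k higher
      where
      j<k : j < suc κ
      j<k = ℕ.≰⇒> κ≮j
      higher : HigherReduce {n} κ r s j
      higher j′ γ′ j<j′ = go t j′ γ′
        (ℕ.≤-trans k≤j+t (≡.subst (_≤ j′ ℕ.+ t) (≡.sym (ℕ.+-suc j t)) (ℕ.+-monoˡ-≤ t j<j′)))
      -- For j ≥ s the power x₁^j suffices to raise e_m step by step to some e_{m′} with m′ > n,
      -- which is 0.
      low : ∀ s → s ≤ j → (∀ m → n < m ℕ.+ s → n < j ℕ.+ m)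
      low s s≤j m n<m+s = ℕ.<-≤-trans n<m+s (≡.subst (m ℕ.+ s ≤_) (ℕ.+-comm m j) (ℕ.+-monoʳ-≤ m s≤j))
      step : ∀ s → s ℕ.+ r ≡ suc κ → HigherReduce {n} κ r s j → Red κ r s (deg (j ∷ γ)) (monomial (j ∷ γ))
      step zero    r≡k   higher = Red-raise j higher
        (λ adm → ≡.subst (j <_) (≡.sym r≡k) j<k , adm)
        (λ m γ d n<m+s → Red-raise-e j m γ n<m+s (low 0 z≤n m n<m+s))
        (Red-monomial κ r 0 r≡k γ)
      step (suc s) s+r≡k higher with j ℕ.<? suc s
      ... | yes j<s = Red-raise j higher
        (λ adm → inj₁ (j<s , adm))
        (λ m γ d → Red-raise-e-higher j m γ higher)
        (Red-monomial κ (suc r) s (≡.trans (ℕ.+-suc s r) s+r≡k) γ)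
      ... | no  j≮s = Red-raise j higher
        (λ adm → inj₂ ((ℕ.≮⇒≥ j≮s , ≡.subst (j <_) (≡.sym s+r≡k) j<k) , adm))
        (λ m γ d n<m+s → Red-raise-e j m γ n<m+s (low (suc s) (ℕ.≮⇒≥ j≮s) m n<m+s))
        (Red-monomial κ r (suc s) s+r≡k γ)

-- Bases of the quotient and of its graded pieces

module Dimension {c ℓ : Level} (F : Field c ℓ) where
  open Field F hiding (zero)
  open Poly F
  open DividedDifferences commutativeRing using (Func; interchange)
  open Pairing F
  open Spanning F

  idealSum : ∀ {n} (gs : List (Pol n)) → Vec (Pol n) (L.length gs) → Pol n
  idealSum gs cs = sumP (V.toList (V.zipWith _*P_ cs (V.fromList gs)))

  ⟨⟩-idealSum-∷ : ∀ {n} (φ : Func n) g gs q cs →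
    ⟨ φ , idealSum (g ∷ gs) (q ∷ cs) ⟩ ≈ ⟨ (λ α → ⟨ shift α φ , g ⟩) , q ⟩ + ⟨ φ , idealSum gs cs ⟩
  ⟨⟩-idealSum-∷ φ g gs q cs = trans (⟨⟩-++ φ (q *P g) _) (+-congʳ (⟨⟩-* φ q g))

  ⟨⟩-idealSum-+ : ∀ {n} (φ : Func n) gs cs ds →
    ⟨ φ , idealSum gs (V.zipWith _+P_ cs ds) ⟩ ≈ ⟨ φ , idealSum gs cs ⟩ + ⟨ φ , idealSum gs ds ⟩
  ⟨⟩-idealSum-+ φ []       []       []       = sym (+-identityˡ 0#)
  ⟨⟩-idealSum-+ φ (g ∷ gs) (p ∷ cs) (q ∷ ds) = trans (⟨⟩-idealSum-∷ φ g gs (p +P q) (V.zipWith _+P_ cs ds))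
    (trans (+-cong (⟨⟩-++ _ p q) (⟨⟩-idealSum-+ φ gs cs ds))
      (trans (interchange _ _ _ _)
        (+-cong (sym (⟨⟩-idealSum-∷ φ g gs p cs)) (sym (⟨⟩-idealSum-∷ φ g gs q ds)))))

  ⟨⟩-idealSum-· : ∀ {n} (φ : Func n) a gs cs →
    ⟨ φ , idealSum gs (V.map (a ·P_) cs) ⟩ ≈ a * ⟨ φ , idealSum gs cs ⟩
  ⟨⟩-idealSum-· φ a []       []       = sym (zeroʳ a)
  ⟨⟩-idealSum-· φ a (g ∷ gs) (q ∷ cs) = trans (⟨⟩-idealSum-∷ φ g gs (a ·P q) (V.map (a ·P_) cs))
    (trans (+-cong (⟨⟩-· _ a q) (⟨⟩-idealSum-· φ a gs cs))
      (trans (sym (distribˡ a _ _)) (*-congˡ (sym (⟨⟩-idealSum-∷ φ g gs q cs)))))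

  ⟨⟩-idealSum-0 : ∀ {n} (φ : Func n) gs → ⟨ φ , idealSum gs (V.replicate _ []) ⟩ ≈ 0#
  ⟨⟩-idealSum-0 φ []       = refl
  ⟨⟩-idealSum-0 φ (g ∷ gs) = ⟨⟩-idealSum-0 φ gs

  multiple-∈-ideal : ∀ {n gs} {g : Pol n} → g ∈ gs → ∀ q →
    Σ (Vec (Pol n) (L.length gs)) λ cs → (q *P g) ≃ idealSum gs cs
  multiple-∈-ideal {gs = g ∷ gs} (here ≡.refl) q = (q ∷ V.replicate _ []) , λ φ → sym
    (trans (⟨⟩-++ φ (q *P g) _) (trans (+-congˡ (⟨⟩-idealSum-0 φ gs)) (+-identityʳ _)))
  multiple-∈-ideal {gs = _ ∷ gs} (there g∈gs) q with multiple-∈-ideal g∈gs q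
  ... | cs , q*g≃ = ([] ∷ cs) , q*g≃

  ⟨⟩-linComb-+ : ∀ {n} (φ : Func n) bs a a′ →
    ⟨ φ , linComb (λ i → a i + a′ i) (basis bs) ⟩ ≈ ⟨ φ , linComb a (basis bs) ⟩ + ⟨ φ , linComb a′ (basis bs) ⟩
  ⟨⟩-linComb-+ φ []       a a′ = sym (+-identityˡ 0#)
  ⟨⟩-linComb-+ φ (b ∷ bs) a a′ = trans (⟨⟩-linComb-∷ φ b bs (λ i → a i + a′ i))
    (trans (+-cong (distribʳ _ _ _) (⟨⟩-linComb-+ φ bs _ _))
      (trans (interchange _ _ _ _)
        (+-cong (sym (⟨⟩-linComb-∷ φ b bs a)) (sym (⟨⟩-linComb-∷ φ b bs a′)))))

  ⟨⟩-linComb-· : ∀ {n} (φ : Func n) x bs a →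
    ⟨ φ , linComb (λ i → x * a i) (basis bs) ⟩ ≈ x * ⟨ φ , linComb a (basis bs) ⟩
  ⟨⟩-linComb-· φ x []       a = sym (zeroʳ x)
  ⟨⟩-linComb-· φ x (b ∷ bs) a = trans (⟨⟩-linComb-∷ φ b bs (λ i → x * a i))
    (trans (+-cong (*-assoc _ _ _) (⟨⟩-linComb-· φ x bs _))
      (trans (sym (distribˡ x _ _)) (*-congˡ (sym (⟨⟩-linComb-∷ φ b bs a)))))

  ⟨⟩-linComb-zero : ∀ {n} (φ : Func n) bs → ⟨ φ , linComb (λ _ → 0#) (basis bs) ⟩ ≈ 0#
  ⟨⟩-linComb-zero φ []       = refl
  ⟨⟩-linComb-zero φ (b ∷ bs) = trans (⟨⟩-linComb-∷ φ b bs (λ _ → 0#))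
    (trans (+-cong (zeroˡ _) (⟨⟩-linComb-zero φ bs)) (+-identityˡ 0#))

  monomial-∈-span : ∀ {n bs} {b : Mon n} → b ∈ bs →
    Σ (Fin (L.length bs) → Carrier) λ a → monomial b ≃ linComb a (basis bs)
  monomial-∈-span {bs = b ∷ bs} (here ≡.refl) = a , λ φ → trans (⟨⟩-monomial φ b) (sym
    (trans (⟨⟩-linComb-∷ φ b bs a)
      (trans (+-cong (*-identityˡ _) (⟨⟩-linComb-zero φ bs)) (+-identityʳ _))))
    where
    a : Fin (suc (L.length bs)) → Carrier
    a Fin.zero    = 1#
    a (Fin.suc i) = 0#
  monomial-∈-span {bs = b′ ∷ bs} (there b∈bs) with monomial-∈-span b∈bs
  ... | a , b≃ = a⁺ , λ φ → trans (b≃ φ) (sym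
    (trans (⟨⟩-linComb-∷ φ b′ bs a⁺) (trans (+-congʳ (zeroˡ _)) (+-identityˡ _))))
    where
    a⁺ : Fin (suc (L.length bs)) → Carrier
    a⁺ Fin.zero    = 0#
    a⁺ (Fin.suc i) = a i

  record Span {n : ℕ} (gs : List (Pol n)) (bs : List (Mon n)) (p : Pol n) : Set (c ⊔ ℓ) where
    constructor spanned
    field
      coefficients : Fin (L.length bs) → Carrier
      cofactors    : Vec (Pol n) (L.length gs)
      combination  : ∀ φ → ⟨ φ , p ⟩ ≈ ⟨ φ , linComb coefficients (basis bs) ⟩ + ⟨ φ , idealSum gs cofactors ⟩

  module _ {n : ℕ} {gs : List (Pol n)} {bs : List (Mon n)} where

    Span-[] : Span gs bs []
    Span-[] = spanned (λ _ → 0#) (V.replicate _ [])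
      λ φ → sym (trans (+-cong (⟨⟩-linComb-zero φ bs) (⟨⟩-idealSum-0 φ gs)) (+-identityˡ 0#))

    Span-+ : ∀ {p q} → Span gs bs p → Span gs bs q → Span gs bs (p +P q)
    Span-+ {p} {q} (spanned a cs p≈) (spanned a′ cs′ q≈) = spanned (λ i → a i + a′ i) (V.zipWith _+P_ cs cs′)
      λ φ → trans (⟨⟩-++ φ p q) (trans (+-cong (p≈ φ) (q≈ φ)) (trans (interchange _ _ _ _)
        (+-cong (sym (⟨⟩-linComb-+ φ bs a a′)) (sym (⟨⟩-idealSum-+ φ gs cs cs′)))))

    Span-· : ∀ x {p} → Span gs bs p → Span gs bs (x ·P p)
    Span-· x {p} (spanned a cs p≈) = spanned (λ i → x * a i) (V.map (x ·P_) cs)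
      λ φ → trans (⟨⟩-· φ x p) (trans (*-congˡ (p≈ φ)) (trans (distribˡ x _ _)
        (+-cong (sym (⟨⟩-linComb-· φ x bs a)) (sym (⟨⟩-idealSum-· φ x gs cs)))))

    Span-≃ : ∀ {p q} → p ≃ q → Span gs bs p → Span gs bs q
    Span-≃ p≃q (spanned a cs p≈) = spanned a cs λ φ → trans (sym (p≃q φ)) (p≈ φ)

    Span-basis : ∀ {b} → b ∈ bs → Span gs bs (monomial b)
    Span-basis b∈bs with monomial-∈-span b∈bs
    ... | a , b≃ = spanned a (V.replicate _ [])
      λ φ → trans (b≃ φ) (sym (trans (+-congˡ (⟨⟩-idealSum-0 φ gs)) (+-identityʳ _)))

    Span-multiple : ∀ {g} → g ∈ gs → ∀ q → Span gs bs (q *P g)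
    Span-multiple g∈gs q with multiple-∈-ideal g∈gs q
    ... | cs , q*g≃ = spanned (λ _ → 0#) cs
      λ φ → trans (q*g≃ φ) (sym (trans (+-congʳ (⟨⟩-linComb-zero φ bs)) (+-identityˡ _)))

    Span-monomials : ∀ p → AllL (λ t → Span gs bs (monomial (proj₂ t))) p → Span gs bs p
    Span-monomials []            []             = Span-[]
    Span-monomials ((x , α) ∷ p) (span ∷ spans) = Span-≃
      {p = (x ·P monomial α) +P p} {q = (x , α) ∷ p} (λ φ → +-congʳ (*-congʳ (*-identityʳ x)))
      (Span-+ (Span-· x span) (Span-monomials p spans))

    Span⇒InIdeal : ∀ {p} → Span gs bs p →
                   Σ (Fin (L.length bs) → Carrier) λ a → InIdeal gs (p +P (-P linComb a (basis bs)))
    Span⇒InIdeal {p} (spanned a cs p≈) = a , cs , ≃⇒≐ {p = p +P (-P lc)} {q = idealSum gs cs} λ φ → begin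
      ⟨ φ , p +P (-P lc) ⟩                                        ≈⟨ ⟨⟩-++ φ p (-P lc) ⟩
      ⟨ φ , p ⟩ + ⟨ φ , -P lc ⟩                                   ≈⟨ +-cong (p≈ φ) (⟨⟩-- φ lc) ⟩
      (⟨ φ , lc ⟩ + ⟨ φ , idealSum gs cs ⟩) + - ⟨ φ , lc ⟩        ≈⟨ +-congʳ (+-comm _ _) ⟩
      (⟨ φ , idealSum gs cs ⟩ + ⟨ φ , lc ⟩) + - ⟨ φ , lc ⟩        ≈⟨ +-assoc _ _ _ ⟩
      ⟨ φ , idealSum gs cs ⟩ + (⟨ φ , lc ⟩ + - ⟨ φ , lc ⟩)        ≈⟨ +-congˡ (-‿inverseʳ _) ⟩
      ⟨ φ , idealSum gs cs ⟩ + 0#                                 ≈⟨ +-identityʳ _ ⟩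
      ⟨ φ , idealSum gs cs ⟩ ∎
      where
      open SetoidReasoning setoid
      lc = linComb a (basis bs)

  h-∈-gensJ : ∀ {n k i} → i < n → h n k (suc i) ∈ gensJ n k
  h-∈-gensJ {n} {k} i<n = ∈-++⁺ˡ (∈-map⁺ (λ i → h n k (suc i)) (∈-upTo⁺ i<n))

  -- The generator stands at t = n - m, and t < k amounts to n < m + k.
  e-∈-gensJ : ∀ {n k m} → m ≤ n → n < m ℕ.+ k → e n m ∈ gensJ n k
  e-∈-gensJ {n} {k} {m} m≤n n<m+k = ≡.subst (λ m → e n m ∈ gensJ n k) (ℕ.m∸[m∸n]≡n m≤n)
    (∈-++⁺ʳ (map (λ i → h n k (suc i)) (upTo n))
      (∈-map⁺ (λ t → e n (n ℕ.∸ t)) (∈-upTo⁺ (ℕ.+-cancelˡ-< m _ _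
        (≡.subst (_< m ℕ.+ k) (≡.sym (ℕ.m+[n∸m]≡n m≤n)) n<m+k)))))

  Red⇒Span : ∀ {n κ d bs} → (∀ {α : Mon n} → Admissible 0 (suc κ) α → deg α ≡ d → α ∈ bs) →
             ∀ {p} → Red κ 0 (suc κ) d p → Span (gensJ n (suc κ)) bs p
  Red⇒Span {n} {κ} complete zero = Span-[]
  Red⇒Span complete (add {p} {q} redp redq)    = Span-+ {p = p} {q} (Red⇒Span complete redp) (Red⇒Span complete redq)
  Red⇒Span complete (scale a {p} red)          = Span-· a {p} (Red⇒Span complete red)
  Red⇒Span complete (resp {p} {q} p≃q red)     = Span-≃ {p = p} {q} p≃q (Red⇒Span complete red)
  Red⇒Span complete (standard adm deg≡)        = Span-basis (complete adm deg≡)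
  Red⇒Span complete (h-mult γ i i<n deg≡)      = Span-multiple (h-∈-gensJ i<n) (monomial γ)
  Red⇒Span {n} complete (e-mult γ m n<m+k deg≡) with m ℕ.≤? n
  ... | yes m≤n = Span-multiple (e-∈-gensJ m≤n n<m+k) (monomial γ)
  -- `Red` admits e_m with m > n, which is zero and not listed in `gensJ`.
  ... | no  m≰n = Span-≃ {p = []} {q = monomial γ *P e n m}
    (λ φ → sym (monomial-*-e-vanishes γ m (ℕ.≰⇒> m≰n) φ)) Span-[]

  -- `Homogeneous` constrains coefficients only: the list may contain terms of other degrees that
  -- cancel. They must go before the terms can be reduced one by one within degree d.
  keepDegree : ∀ {n} → ℕ → Pol n → Pol n
  keepDegree d []            = []
  keepDegree d ((b , β) ∷ p) with deg β ℕ.≟ d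
  ... | yes _ = (b , β) ∷ keepDegree d p
  ... | no  _ = keepDegree d p

  keepDegree-degree : ∀ {n} d (p : Pol n) → AllL (λ t → deg (proj₂ t) ≡ d) (keepDegree d p)
  keepDegree-degree d []            = []
  keepDegree-degree d ((b , β) ∷ p) with deg β ℕ.≟ d
  ... | yes degβ = degβ ∷ keepDegree-degree d p
  ... | no  _    = keepDegree-degree d p

  coeff-keepDegree : ∀ {n} d (p : Pol n) α → deg α ≡ d → coeff (keepDegree d p) α ≈ coeff p α
  coeff-keepDegree d []            α degα = refl
  coeff-keepDegree d ((b , β) ∷ p) α degα with deg β ℕ.≟ d
  ... | yes _ with ≡-dec ℕ._≟_ β α
  ...   | yes _ = +-congˡ (coeff-keepDegree d p α degα)
  ...   | no  _ = coeff-keepDegree d p α degα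
  coeff-keepDegree d ((b , β) ∷ p) α degα | no degβ≢d with ≡-dec ℕ._≟_ β α
  ...   | yes ≡.refl = contradiction degα degβ≢d
  ...   | no  _      = coeff-keepDegree d p α degα

  keepDegree-homogeneous : ∀ {n} d (p : Pol n) → Homogeneous d (keepDegree d p)
  keepDegree-homogeneous d []            α degα≢d = refl
  keepDegree-homogeneous d ((b , β) ∷ p) α degα≢d with deg β ℕ.≟ d
  ... | no  _ = keepDegree-homogeneous d p α degα≢d
  ... | yes degβ≡d with ≡-dec ℕ._≟_ β α
  ...   | yes ≡.refl = contradiction degβ≡d degα≢d
  ...   | no  _      = keepDegree-homogeneous d p α degα≢d

  homogeneous-≃ : ∀ {n} d (p : Pol n) → Homogeneous d p → keepDegree d p ≃ p
  homogeneous-≃ d p hom = ≐⇒≃ {p = keepDegree d p} {q = p} go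
    where
    go : keepDegree d p ≐ p
    go α with deg α ℕ.≟ d
    ... | yes degα = coeff-keepDegree d p α degα
    ... | no  degα = trans (keepDegree-homogeneous d p α degα) (sym (hom α degα))

  monomial-homogeneous : ∀ {n d} (α : Mon n) → deg α ≡ d → Homogeneous d (monomial α)
  monomial-homogeneous α degα β degβ≢d with ≡-dec ℕ._≟_ α β
  ... | yes ≡.refl = contradiction degα degβ≢d
  ... | no  _      = refl

  dimGradedS : ∀ n κ d (bs : List (Mon n)) → κ < n →
    AllL (λ α → Admissible 0 (suc κ) α × deg α ≡ d) bs → AllPairs _<ₗ_ bs →
    (∀ {α} → Admissible 0 (suc κ) α → deg α ≡ d → α ∈ bs) →
    dimGradedS≡ n (suc κ) d (L.length bs)
  dimGradedS n κ d bs κ<n sound sorted complete =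
    basis bs ,
    (λ i → monomial-homogeneous (L.lookup bs i) (proj₂ (All.lookup sound (∈-lookup i)))) ,
    (λ p hom → Span⇒InIdeal {p = p} (Span-≃ {p = keepDegree d p} {q = p} (homogeneous-≃ d p hom)
      (Span-monomials (keepDegree d p)
        (All.map (λ {t} degt → Red⇒Span complete
                   (≡.subst (λ d → Red κ 0 (suc κ) d (monomial (proj₂ t))) degt
                     (Red-monomial κ 0 (suc κ) (ℕ.+-identityʳ (suc κ)) (proj₂ t))))
                 (keepDegree-degree d p))))) ,
    admissible-independent n κ bs κ<n (All.map proj₁ sound) sorted

  dimS : ∀ n κ (bs : List (Mon n)) → κ < n → AllL (Admissible 0 (suc κ)) bs → AllPairs _<ₗ_ bs →
    (∀ {α} → Admissible 0 (suc κ) α → α ∈ bs) →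
    dimS≡ n (suc κ) (L.length bs)
  dimS n κ bs κ<n sound sorted complete =
    basis bs ,
    (λ _ → lift _) ,
    (λ p _ → Span⇒InIdeal {p = p} (Span-monomials p
      (All.universal (λ t → Red⇒Span (λ adm _ → complete adm)
        (Red-monomial κ 0 (suc κ) (ℕ.+-identityʳ (suc κ)) (proj₂ t))) p))) ,
    admissible-independent n κ bs κ<n sound sorted

-- Counting admissible monomials by degree

layers : ∀ {n} → ℕ → ℕ → List (Vec ℕ n) → List (Vec ℕ (suc n))
layers lo zero    ms = []
layers lo (suc m) ms = layers lo m ms ++ map (lo ℕ.+ m ∷_) ms

-- The first exponents increase through both blocks, so the list is in lexicographic order, as the
-- triangular argument requires.
standardMonomials : ∀ N → ℕ → ℕ → List (Vec ℕ N)
standardMonomials zero    r zero    = [] ∷ []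
standardMonomials zero    r (suc s) = []
standardMonomials (suc N) r zero    = layers 0 r (standardMonomials N r 0)
standardMonomials (suc N) r (suc s) =
  layers 0 (suc s) (standardMonomials N (suc r) s) ++ layers (suc s) r (standardMonomials N r (suc s))

∈-layers : ∀ {n} lo m {ms} {a} {α : Vec ℕ n} → lo ≤ a → a < lo ℕ.+ m → α ∈ ms → a ∷ α ∈ layers lo m ms
∈-layers lo zero    lo≤a a<lo+m α∈ms =
  contradiction (ℕ.≤-trans a<lo+m (≡.subst (_≤ _) (≡.sym (ℕ.+-identityʳ lo)) lo≤a)) (ℕ.<-irrefl ≡.refl)
∈-layers lo (suc m) {ms} {a} {α} lo≤a a<lo+m α∈ms with a ℕ.≟ lo ℕ.+ m
... | yes ≡.refl = ∈-++⁺ʳ (layers lo m ms) (∈-map⁺ (a ∷_) α∈ms)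
... | no  a≢     = ∈-++⁺ˡ (∈-layers lo m lo≤a
  (ℕ.≤∧≢⇒< (ℕ.≤-pred (≡.subst (suc a ≤_) (ℕ.+-suc lo m) a<lo+m)) a≢) α∈ms)

All-layers : ∀ {n p q} {P : Vec ℕ n → Set p} {Q : Vec ℕ (suc n) → Set q} lo m {ms} →
             (∀ {a α} → lo ≤ a → a < lo ℕ.+ m → P α → Q (a ∷ α)) → AllL P ms → AllL Q (layers lo m ms)
All-layers lo zero    f ps = []
All-layers lo (suc m) f ps = All.++⁺
  (All-layers lo m (λ lo≤a a< → f lo≤a (ℕ.<-≤-trans a< (ℕ.+-monoʳ-≤ lo (ℕ.n≤1+n m)))) ps)
  (All.map⁺ (All.map (f (ℕ.m≤m+n lo m) (ℕ.+-monoʳ-< lo ℕ.≤-refl)) ps))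

all-⊤ : ∀ {n} (ms : List (Vec ℕ n)) → AllL (λ _ → ⊤) ms
all-⊤ = All.universal λ _ → tt

layers-sorted : ∀ {n} lo m {ms : List (Vec ℕ n)} → AllPairs _<ₗ_ ms → AllPairs _<ₗ_ (layers lo m ms)
layers-sorted lo zero    sorted = []
layers-sorted lo (suc m) {ms} sorted = AllPairs.++⁺
  (layers-sorted lo m sorted)
  (AllPairs.map⁺ (cons-sorted ms sorted))
  (All-layers lo m (λ _ a<lo+m _ → All.map⁺ (All.universal (λ _ → inj₁ a<lo+m) ms)) (all-⊤ ms))
  where
  cons-sorted : ∀ ms → AllPairs _<ₗ_ ms → AllPairs (λ α β → lo ℕ.+ m ∷ α <ₗ lo ℕ.+ m ∷ β) ms
  cons-sorted []       []              = []
  cons-sorted (α ∷ ms) (α<ms ∷ sorted) = All.map (λ α<β → inj₂ (≡.refl , α<β)) α<ms ∷ cons-sorted ms sorted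

standardMonomials-sorted : ∀ N r s → AllPairs _<ₗ_ (standardMonomials N r s)
standardMonomials-sorted zero    r zero    = [] ∷ []
standardMonomials-sorted zero    r (suc s) = []
standardMonomials-sorted (suc N) r zero    = layers-sorted 0 r (standardMonomials-sorted N r 0)
standardMonomials-sorted (suc N) r (suc s) = AllPairs.++⁺
  (layers-sorted 0 (suc s) (standardMonomials-sorted N (suc r) s))
  (layers-sorted (suc s) r (standardMonomials-sorted N r (suc s)))
  (All-layers 0 (suc s)
    (λ _ a<1+s _ → All-layers (suc s) r (λ 1+s≤b _ _ → inj₁ (ℕ.<-≤-trans a<1+s 1+s≤b)) (all-⊤ _))
    (all-⊤ (standardMonomials N (suc r) s)))

standardMonomials-sound : ∀ N r s → AllL (Admissible r s) (standardMonomials N r s)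
standardMonomials-sound zero    r zero    = ≡.refl ∷ []
standardMonomials-sound zero    r (suc s) = []
standardMonomials-sound (suc N) r zero    = All-layers 0 r (λ _ a<r adm → a<r , adm) (standardMonomials-sound N r 0)
standardMonomials-sound (suc N) r (suc s) = All.++⁺
  (All-layers 0 (suc s) (λ _ a<1+s adm → inj₁ (a<1+s , adm)) (standardMonomials-sound N (suc r) s))
  (All-layers (suc s) r (λ s<a a<k adm → inj₂ ((s<a , a<k) , adm)) (standardMonomials-sound N r (suc s)))

standardMonomials-complete : ∀ {N} r s {α : Vec ℕ N} → Admissible r s α → α ∈ standardMonomials N r s
standardMonomials-complete r s       {[]}    ≡.refl       = here ≡.refl
standardMonomials-complete r zero    {a ∷ α} (a<r , adm)  = ∈-layers 0 r z≤n a<r (standardMonomials-complete r 0 adm)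
standardMonomials-complete r (suc s) {a ∷ α} (inj₁ (a<1+s , adm)) =
  ∈-++⁺ˡ (∈-layers 0 (suc s) z≤n a<1+s (standardMonomials-complete (suc r) s adm))
standardMonomials-complete {suc N} r (suc s) {a ∷ α} (inj₂ ((s<a , a<k) , adm)) =
  ∈-++⁺ʳ (layers 0 (suc s) (standardMonomials N (suc r) s))
    (∈-layers (suc s) r s<a a<k (standardMonomials-complete r (suc s) adm))

length-layers : ∀ {n} lo m (ms : List (Vec ℕ n)) → L.length (layers lo m ms) ≡ m ℕ.* L.length ms
length-layers lo zero    ms = ≡.refl
length-layers lo (suc m) ms = ≡.trans (L.length-++ (layers lo m ms))
  (≡.trans (≡.cong₂ ℕ._+_ (length-layers lo m ms) (L.length-map (lo ℕ.+ m ∷_) ms)) (ℕ.+-comm _ (L.length ms)))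

size : ℕ → ℕ → ℕ → ℕ
size N r s = L.length (standardMonomials N r s)

size-zero : ∀ N r → size (suc N) r 0 ≡ r ℕ.* size N r 0
size-zero N r = length-layers 0 r (standardMonomials N r 0)

size-suc : ∀ N r s → size (suc N) r (suc s) ≡ suc s ℕ.* size N (suc r) s ℕ.+ r ℕ.* size N r (suc s)
size-suc N r s = ≡.trans (L.length-++ (layers 0 (suc s) (standardMonomials N (suc r) s)))
  (≡.cong₂ ℕ._+_ (length-layers 0 (suc s) (standardMonomials N (suc r) s))
                 (length-layers (suc s) r (standardMonomials N r (suc s))))

-- The case q = 1 of `dual-split`. At r = 0 it expresses r = 1 through r = 0, which closes the
-- recurrence in `size-stir`.
size-split : ∀ N r s → size N (suc r) s ≡ size N r s ℕ.+ size N r (suc s)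
size-split zero    r zero    = ≡.refl
size-split zero    r (suc s) = ≡.refl
size-split (suc N) r zero
  rewrite size-zero N (suc r) | size-zero N r | size-suc N r 0 | size-split N r 0 =
  solve 3 (λ r x y → (con 1 :+ r) :* (x :+ y) := r :* x :+ (con 1 :* (x :+ y) :+ r :* y)) ≡.refl
    r (size N r 0) (size N r 1)
  where open +-*-Solver
size-split (suc N) r (suc s)
  rewrite size-suc N (suc r) s | size-suc N r s | size-suc N r (suc s) | size-split N (suc r) s | size-split N r (suc s) =
  solve 5 (λ r s x y z → (con 1 :+ s) :* (x :+ (y :+ z)) :+ (con 1 :+ r) :* (y :+ z) :=
                         ((con 1 :+ s) :* x :+ r :* y) :+ ((con 2 :+ s) :* (y :+ z) :+ r :* z)) ≡.refl
    r s (size N (suc r) s) (size N r (suc s)) (size N r (suc (suc s)))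
  where open +-*-Solver

size-stir : ∀ n k → size n 0 k ≡ k ! ℕ.* stir n k
size-stir zero    zero    = ≡.refl
size-stir zero    (suc k) = ≡.sym (ℕ.*-zeroʳ (suc k !))
size-stir (suc n) zero    = ≡.refl
size-stir (suc n) (suc k)
  rewrite size-suc n 0 k | size-split n 0 k | size-stir n k | size-stir n (suc k) =
  solve 4 (λ k f x y → (con 1 :+ k) :* (f :* x :+ ((con 1 :+ k) :* f) :* y) :+ con 0 :=
                       ((con 1 :+ k) :* f) :* (x :+ (con 1 :+ k) :* y)) ≡.refl
    k (k !) (stir n k) (stir n (suc k))
  where open +-*-Solver

-- Power series in q with coefficients in ℕ: sh is multiplication by q, box m by [m]_q.
sh : (ℕ → ℕ) → ℕ → ℕ
sh f zero    = 0
sh f (suc d) = f d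

shⁿ : ℕ → (ℕ → ℕ) → ℕ → ℕ
shⁿ zero    f = f
shⁿ (suc n) f = sh (shⁿ n f)

_⊕_ : (ℕ → ℕ) → (ℕ → ℕ) → ℕ → ℕ
(f ⊕ g) d = f d ℕ.+ g d

𝟎 : ℕ → ℕ
𝟎 _ = 0

box : ℕ → (ℕ → ℕ) → ℕ → ℕ
box zero    f = 𝟎
box (suc m) f = f ⊕ sh (box m f)

sh-cong : ∀ {f g} → f ≗ g → sh f ≗ sh g
sh-cong f≗g zero    = ≡.refl
sh-cong f≗g (suc d) = f≗g d

sh-⊕ : ∀ f g → sh (f ⊕ g) ≗ sh f ⊕ sh g
sh-⊕ f g zero    = ≡.refl
sh-⊕ f g (suc d) = ≡.refl

sh-𝟎 : sh 𝟎 ≗ 𝟎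
sh-𝟎 zero    = ≡.refl
sh-𝟎 (suc d) = ≡.refl

shⁿ-cong : ∀ n {f g} → f ≗ g → shⁿ n f ≗ shⁿ n g
shⁿ-cong zero    f≗g = f≗g
shⁿ-cong (suc n) f≗g = sh-cong (shⁿ-cong n f≗g)

shⁿ-⊕ : ∀ n f g → shⁿ n (f ⊕ g) ≗ shⁿ n f ⊕ shⁿ n g
shⁿ-⊕ zero    f g d = ≡.refl
shⁿ-⊕ (suc n) f g d = ≡.trans (sh-cong (shⁿ-⊕ n f g) d) (sh-⊕ _ _ d)

shⁿ-𝟎 : ∀ n → shⁿ n 𝟎 ≗ 𝟎
shⁿ-𝟎 zero    d = ≡.refl
shⁿ-𝟎 (suc n) d = ≡.trans (sh-cong (shⁿ-𝟎 n) d) (sh-𝟎 d)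

shⁿ-sh : ∀ n f → shⁿ n (sh f) ≗ sh (shⁿ n f)
shⁿ-sh zero    f d = ≡.refl
shⁿ-sh (suc n) f d = sh-cong (shⁿ-sh n f) d

box-cong : ∀ m {f g} → f ≗ g → box m f ≗ box m g
box-cong zero    f≗g d = ≡.refl
box-cong (suc m) f≗g d = ≡.cong₂ ℕ._+_ (f≗g d) (sh-cong (box-cong m f≗g) d)

+-interchange : ∀ w x y z → (w ℕ.+ x) ℕ.+ (y ℕ.+ z) ≡ (w ℕ.+ y) ℕ.+ (x ℕ.+ z)
+-interchange = solve 4 (λ w x y z → (w :+ x) :+ (y :+ z) := (w :+ y) :+ (x :+ z)) ≡.refl
  where open +-*-Solver

box-⊕ : ∀ m f g → box m (f ⊕ g) ≗ box m f ⊕ box m g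
box-⊕ zero    f g d = ≡.refl
box-⊕ (suc m) f g d = ≡.trans
  (≡.cong (f d ℕ.+ g d ℕ.+_) (≡.trans (sh-cong (box-⊕ m f g) d) (sh-⊕ _ _ d)))
  (+-interchange (f d) (g d) _ _)

box-𝟎 : ∀ m → box m 𝟎 ≗ 𝟎
box-𝟎 zero    d = ≡.refl
box-𝟎 (suc m) d = ≡.trans (sh-cong (box-𝟎 m) d) (sh-𝟎 d)

box-sh : ∀ m f → box m (sh f) ≗ sh (box m f)
box-sh zero    f d = ≡.sym (sh-𝟎 d)
box-sh (suc m) f d = ≡.trans (≡.cong (sh f d ℕ.+_) (sh-cong (box-sh m f) d)) (≡.sym (sh-⊕ _ _ d))

box-shⁿ : ∀ m n f → box m (shⁿ n f) ≗ shⁿ n (box m f)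
box-shⁿ m zero    f d = ≡.refl
box-shⁿ m (suc n) f d = ≡.trans (box-sh m (shⁿ n f) d) (sh-cong (box-shⁿ m n f) d)

-- [m+1] = [m] + q^m, against the defining [m+1] = 1 + q [m]; `dual-split` plays the two off against
-- each other.
box-snoc : ∀ m f → box (suc m) f ≗ box m f ⊕ shⁿ m f
box-snoc zero    f d = ≡.trans (≡.cong (f d ℕ.+_) (sh-𝟎 d)) (ℕ.+-identityʳ (f d))
box-snoc (suc m) f d = ≡.trans
  (≡.cong (f d ℕ.+_) (≡.trans (sh-cong (box-snoc m f) d) (sh-⊕ _ _ d)))
  (≡.sym (ℕ.+-assoc (f d) _ _))

-- The generating function of the standard monomials by codegree, that is, by
-- top N r s minus the degree.
dual : ℕ → ℕ → ℕ → ℕ → ℕ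
dual zero    r zero    = coeffq (1 ∷ [])
dual zero    r (suc s) = 𝟎
dual (suc N) r zero    = box r (dual N r 0)
dual (suc N) r (suc s) = box (suc s) (dual N (suc r) s) ⊕ box r (dual N r (suc s))

-- Put X = G(N,r+1,s+1). Expanding G(N+1,r+1,s+1) by induction produces q^{r+1} [s+1] X from the
-- first block and, by [r+1] = [r] + q^r, a term q^r X from the second. Together they are q^r [s+2]
-- X, the first block of q^r G(N+1,r,s+2).
dual-split : ∀ N r s → dual N (suc r) s ≗ dual N r s ⊕ shⁿ r (dual N r (suc s))
dual-split zero    r zero    d = ≡.sym (≡.trans (≡.cong (coeffq (1 ∷ []) d ℕ.+_) (shⁿ-𝟎 r d)) (ℕ.+-identityʳ _))
dual-split zero    r (suc s) d = ≡.sym (shⁿ-𝟎 r d)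
dual-split (suc N) r zero    d = begin
  box (suc r) X d
    ≡⟨ box-snoc r X d ⟩
  box r X d ℕ.+ shⁿ r X d
    ≡⟨ ≡.cong (ℕ._+ shⁿ r X d) (≡.trans (box-cong r (dual-split N r 0) d) (box-⊕ r Y (shⁿ r Z) d)) ⟩
  (box r Y d ℕ.+ box r (shⁿ r Z) d) ℕ.+ shⁿ r X d
    ≡⟨ ≡.cong (λ x → (box r Y d ℕ.+ x) ℕ.+ shⁿ r X d) (box-shⁿ r r Z d) ⟩
  (box r Y d ℕ.+ shⁿ r (box r Z) d) ℕ.+ shⁿ r X d
    ≡⟨ solve 3 (λ x y z → (x :+ y) :+ z := x :+ (z :+ y)) ≡.refl (box r Y d) _ _ ⟩
  box r Y d ℕ.+ (shⁿ r X d ℕ.+ shⁿ r (box r Z) d)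
    ≡⟨ ≡.cong (λ x → box r Y d ℕ.+ (x ℕ.+ shⁿ r (box r Z) d))
         (shⁿ-cong r (λ d → ≡.trans (≡.cong (X d ℕ.+_) (sh-𝟎 d)) (ℕ.+-identityʳ (X d))) d) ⟨
  box r Y d ℕ.+ (shⁿ r (box 1 X) d ℕ.+ shⁿ r (box r Z) d)
    ≡⟨ ≡.cong (box r Y d ℕ.+_) (shⁿ-⊕ r (box 1 X) (box r Z) d) ⟨
  box r Y d ℕ.+ shⁿ r (box 1 X ⊕ box r Z) d ∎
  where
  open ≡-Reasoning
  open +-*-Solver
  X = dual N (suc r) 0
  Y = dual N r 0
  Z = dual N r 1
dual-split (suc N) r (suc s) d = begin
  box (suc s) (dual N (suc (suc r)) s) d ℕ.+ box (suc r) X d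
    ≡⟨ ≡.cong₂ ℕ._+_ (≡.trans (box-cong (suc s) (dual-split N (suc r) s) d) (box-⊕ (suc s) W (shⁿ (suc r) X) d))
                     (box-snoc r X d) ⟩
  (box (suc s) W d ℕ.+ box (suc s) (shⁿ (suc r) X) d) ℕ.+ (box r X d ℕ.+ shⁿ r X d)
    ≡⟨ ≡.cong₂ (λ x y → (box (suc s) W d ℕ.+ x) ℕ.+ (y ℕ.+ shⁿ r X d))
         (≡.trans (box-shⁿ (suc s) (suc r) X d) (≡.sym (shⁿ-sh r (box (suc s) X) d)))
         (≡.trans (≡.trans (box-cong r (dual-split N r (suc s)) d) (box-⊕ r Y (shⁿ r Z) d))
           (≡.cong (box r Y d ℕ.+_) (box-shⁿ r r Z d))) ⟩
  (box (suc s) W d ℕ.+ shⁿ r (sh (box (suc s) X)) d) ℕ.+ ((box r Y d ℕ.+ shⁿ r (box r Z) d) ℕ.+ shⁿ r X d)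
    ≡⟨ solve 5 (λ w b y z x → (w :+ b) :+ ((y :+ z) :+ x) := (w :+ y) :+ ((x :+ b) :+ z)) ≡.refl
         (box (suc s) W d) _ (box r Y d) _ _ ⟩
  (box (suc s) W d ℕ.+ box r Y d) ℕ.+ ((shⁿ r X d ℕ.+ shⁿ r (sh (box (suc s) X)) d) ℕ.+ shⁿ r (box r Z) d)
    ≡⟨ ≡.cong (λ x → (box (suc s) W d ℕ.+ box r Y d) ℕ.+ (x ℕ.+ shⁿ r (box r Z) d))
         (shⁿ-⊕ r X (sh (box (suc s) X)) d) ⟨
  (box (suc s) W d ℕ.+ box r Y d) ℕ.+ (shⁿ r (box (suc (suc s)) X) d ℕ.+ shⁿ r (box r Z) d)
    ≡⟨ ≡.cong (box (suc s) W d ℕ.+ box r Y d ℕ.+_) (shⁿ-⊕ r (box (suc (suc s)) X) (box r Z) d) ⟨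
  (box (suc s) W d ℕ.+ box r Y d) ℕ.+ shⁿ r (box (suc (suc s)) X ⊕ box r Z) d ∎
  where
  open ≡-Reasoning
  open +-*-Solver
  X = dual N (suc r) (suc s)
  W = dual N (suc r) s
  Y = dual N r (suc s)
  Z = dual N r (suc (suc s))

-- Products of coefficient lists and the q-Stirling numbers

-- The right factor is a coefficient function, so trailing zeros of lists never enter the algebra.
conv : QPol → (ℕ → ℕ) → ℕ → ℕ
conv []      g = 𝟎
conv (a ∷ f) g = (λ d → a ℕ.* g d) ⊕ sh (conv f g)

coeffq-+ : ∀ f g → coeffq (f +q g) ≗ coeffq f ⊕ coeffq g
coeffq-+ []      g       d       = ≡.refl
coeffq-+ (a ∷ f) []      d       = ≡.sym (ℕ.+-identityʳ _)
coeffq-+ (a ∷ f) (b ∷ g) zero    = ≡.refl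
coeffq-+ (a ∷ f) (b ∷ g) (suc d) = coeffq-+ f g d

coeffq-map : ∀ a f d → coeffq (map (a ℕ.*_) f) d ≡ a ℕ.* coeffq f d
coeffq-map a []      d       = ≡.sym (ℕ.*-zeroʳ a)
coeffq-map a (b ∷ f) zero    = ≡.refl
coeffq-map a (b ∷ f) (suc d) = coeffq-map a f d

coeffq-0∷ : ∀ f → coeffq (0 ∷ f) ≗ sh (coeffq f)
coeffq-0∷ f zero    = ≡.refl
coeffq-0∷ f (suc d) = ≡.refl

coeffq-* : ∀ f g → coeffq (f *q g) ≗ conv f (coeffq g)
coeffq-* []      g d = ≡.refl
coeffq-* (a ∷ f) g d = ≡.trans (coeffq-+ (map (a ℕ.*_) g) (0 ∷ (f *q g)) d)
  (≡.cong₂ ℕ._+_ (coeffq-map a g d) (≡.trans (coeffq-0∷ (f *q g) d) (sh-cong (coeffq-* f g) d)))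

conv-cong : ∀ f {g h} → g ≗ h → conv f g ≗ conv f h
conv-cong []      g≗h d = ≡.refl
conv-cong (a ∷ f) g≗h d = ≡.cong₂ ℕ._+_ (≡.cong (a ℕ.*_) (g≗h d)) (sh-cong (conv-cong f g≗h) d)

conv-⊕ : ∀ f g h → conv f (g ⊕ h) ≗ conv f g ⊕ conv f h
conv-⊕ []      g h d = ≡.refl
conv-⊕ (a ∷ f) g h d = ≡.trans
  (≡.cong₂ ℕ._+_ (ℕ.*-distribˡ-+ a (g d) (h d)) (≡.trans (sh-cong (conv-⊕ f g h) d) (sh-⊕ _ _ d)))
  (+-interchange (a ℕ.* g d) (a ℕ.* h d) _ _)

conv-𝟎 : ∀ f → conv f 𝟎 ≗ 𝟎
conv-𝟎 []      d = ≡.refl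
conv-𝟎 (a ∷ f) d = ≡.cong₂ ℕ._+_ (ℕ.*-zeroʳ a) (≡.trans (sh-cong (conv-𝟎 f) d) (sh-𝟎 d))

conv-sh : ∀ f g → conv f (sh g) ≗ sh (conv f g)
conv-sh []      g d = ≡.sym (sh-𝟎 d)
conv-sh (a ∷ f) g zero    = ≡.trans (ℕ.+-identityʳ _) (ℕ.*-zeroʳ a)
conv-sh (a ∷ f) g (suc d) = ≡.cong (a ℕ.* g d ℕ.+_) (conv-sh f g d)

conv-box : ∀ f m g → conv f (box m g) ≗ box m (conv f g)
conv-box f zero    g d = conv-𝟎 f d
conv-box f (suc m) g d = ≡.trans (conv-⊕ f g (sh (box m g)) d)
  (≡.cong (conv f g d ℕ.+_) (≡.trans (conv-sh f (box m g) d) (sh-cong (conv-box f m g) d)))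

conv-qInt : ∀ m g → conv (qInt m) g ≗ box m g
conv-qInt zero    g d = ≡.refl
conv-qInt (suc m) g d = ≡.cong₂ ℕ._+_ (ℕ.+-identityʳ (g d)) (sh-cong (conv-qInt m g) d)

conv-+q : ∀ f f′ g → conv (f +q f′) g ≗ conv f g ⊕ conv f′ g
conv-+q []      f′       g d = ≡.refl
conv-+q (a ∷ f) []       g d = ≡.sym (ℕ.+-identityʳ _)
conv-+q (a ∷ f) (b ∷ f′) g d = ≡.trans
  (≡.cong₂ ℕ._+_ (ℕ.*-distribʳ-+ (g d) a b) (≡.trans (sh-cong (conv-+q f f′ g) d) (sh-⊕ _ _ d)))
  (+-interchange (a ℕ.* g d) (b ℕ.* g d) _ _)

conv-map : ∀ a f g d → conv (map (a ℕ.*_) f) g d ≡ a ℕ.* conv f g d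
conv-map a []      g d       = ≡.sym (ℕ.*-zeroʳ a)
conv-map a (b ∷ f) g zero    =
  solve 3 (λ a b x → (a :* b) :* x :+ con 0 := a :* (b :* x :+ con 0)) ≡.refl a b (g 0)
  where open +-*-Solver
conv-map a (b ∷ f) g (suc d) = ≡.trans (≡.cong₂ ℕ._+_ (ℕ.*-assoc a b _) (conv-map a f g d))
  (≡.sym (ℕ.*-distribˡ-+ a _ _))

conv-*q : ∀ f f′ g → conv (f *q f′) g ≗ conv f (conv f′ g)
conv-*q []      f′ g d = ≡.refl
conv-*q (a ∷ f) f′ g d = ≡.trans (conv-+q (map (a ℕ.*_) f′) (0 ∷ (f *q f′)) g d)
  (≡.cong₂ ℕ._+_ (conv-map a f′ g d) (sh-cong (conv-*q f f′ g) d))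

-- Multiplying the recurrence of Stir_q by [k+1]!_q gives [k+1] (G(n,0,k) + G(n,0,k+1)). By
-- `dual-split` at r = 0 this is [k+1] G(n,1,k), and for r = 0 the second block of G(n+1,0,k+1) is
-- empty.
qOrderedStir-dual : ∀ n k → coeffq (qFact k *q qStir n k) ≗ dual n 0 k
qOrderedStir-dual zero    zero    d = ≡.refl
qOrderedStir-dual zero    (suc k) d = ≡.trans (coeffq-* (qFact (suc k)) [] d) (conv-𝟎 (qFact (suc k)) d)
qOrderedStir-dual (suc n) zero    d = ≡.trans (coeffq-* (qFact 0) [] d) (conv-𝟎 (qFact 0) d)
qOrderedStir-dual (suc n) (suc k) d = begin
  coeffq (qFact (suc k) *q qStir (suc n) (suc k)) d
    ≡⟨ coeffq-* (qFact (suc k)) (qStir (suc n) (suc k)) d ⟩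
  conv (qFact (suc k)) (coeffq (qStir (suc n) (suc k))) d
    ≡⟨ conv-cong (qFact (suc k)) (λ d → ≡.trans (coeffq-+ (qStir n k) (qInt (suc k) *q qStir n (suc k)) d)
         (≡.cong (S d ℕ.+_) (≡.trans (coeffq-* (qInt (suc k)) (qStir n (suc k)) d) (conv-qInt (suc k) S′ d)))) d ⟩
  conv (qFact (suc k)) (S ⊕ box (suc k) S′) d
    ≡⟨ conv-⊕ (qFact (suc k)) S (box (suc k) S′) d ⟩
  conv (qFact (suc k)) S d ℕ.+ conv (qFact (suc k)) (box (suc k) S′) d
    ≡⟨ ≡.cong₂ ℕ._+_
         (≡.trans (conv-*q (qInt (suc k)) (qFact k) S d) (conv-qInt (suc k) _ d))
         (conv-box (qFact (suc k)) (suc k) S′ d) ⟩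
  box (suc k) (conv (qFact k) S) d ℕ.+ box (suc k) (conv (qFact (suc k)) S′) d
    ≡⟨ box-⊕ (suc k) (conv (qFact k) S) (conv (qFact (suc k)) S′) d ⟨
  box (suc k) (conv (qFact k) S ⊕ conv (qFact (suc k)) S′) d
    ≡⟨ box-cong (suc k) (λ d → ≡.cong₂ ℕ._+_ (≡.sym (coeffq-* (qFact k) (qStir n k) d) ⟨ ≡.trans ⟩ qOrderedStir-dual n k d)
                                             (≡.sym (coeffq-* (qFact (suc k)) (qStir n (suc k)) d) ⟨ ≡.trans ⟩ qOrderedStir-dual n (suc k) d)) d ⟩
  box (suc k) (dual n 0 k ⊕ dual n 0 (suc k)) d
    ≡⟨ box-cong (suc k) (dual-split n 0 k) d ⟨
  box (suc k) (dual n 1 k) d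
    ≡⟨ ℕ.+-identityʳ _ ⟨
  dual (suc n) 0 (suc k) d ∎
  where
  open ≡-Reasoning
  S S′ : ℕ → ℕ
  S  = coeffq (qStir n k)
  S′ = coeffq (qStir n (suc k))

-- Degree against codegree

count : ∀ {n} → List (Vec ℕ n) → ℕ → ℕ
count ms d = L.length (L.filter (λ α → V.sum α ℕ.≟ d) ms)

count-++ : ∀ {n} (ms ms′ : List (Vec ℕ n)) → count (ms ++ ms′) ≗ count ms ⊕ count ms′
count-++ ms ms′ d = ≡.trans (≡.cong L.length (L.filter-++ (λ α → V.sum α ℕ.≟ d) ms ms′))
  (L.length-++ (L.filter (λ α → V.sum α ℕ.≟ d) ms))

count-map : ∀ {n} a (ms : List (Vec ℕ n)) → count (map (a ∷_) ms) ≗ shⁿ a (count ms)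
count-map zero    []       d       = ≡.refl
-- The filter computes through the Boolean test behind `≟`, so abstracting that Boolean lets both
-- sides reduce.
count-map zero    (α ∷ ms) d       with V.sum α ℕ.≡ᵇ d
... | true  = ≡.cong suc (count-map zero ms d)
... | false = count-map zero ms d
count-map (suc a) ms       zero    = ≡.cong L.length (L.filter-none (λ α → V.sum α ℕ.≟ 0)
  (All.map⁺ (All.universal (λ _ ()) ms)))
count-map (suc a) ms       (suc d) = ≡.trans (lower ms) (count-map a ms d)
  where
  lower : ∀ ms → count (map (suc a ∷_) ms) (suc d) ≡ count (map (a ∷_) ms) d
  lower []       = ≡.refl
  lower (α ∷ ms) with a ℕ.+ V.sum α ℕ.≡ᵇ d
  ... | true  = ≡.cong suc (lower ms)
  ... | false = lower ms

-- g is the coefficient sequence of q^D f(1/q).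
record Reversed (D : ℕ) (f g : ℕ → ℕ) : Set where
  field
    reversed : ∀ i j → i ℕ.+ j ≡ D → f i ≡ g j
    boundˡ   : ∀ i → D < i → f i ≡ 0
    boundʳ   : ∀ j → D < j → g j ≡ 0

open Reversed

Reversed-cong : ∀ {D f f′ g g′} → f ≗ f′ → g ≗ g′ → Reversed D f g → Reversed D f′ g′
Reversed-cong f≗ g≗ R = record
  { reversed = λ i j i+j → ≡.trans (≡.sym (f≗ i)) (≡.trans (reversed R i j i+j) (g≗ j))
  ; boundˡ   = λ i D<i → ≡.trans (≡.sym (f≗ i)) (boundˡ R i D<i)
  ; boundʳ   = λ j D<j → ≡.trans (≡.sym (g≗ j)) (boundʳ R j D<j) }

Reversed-𝟎 : ∀ D {f g} → f ≗ 𝟎 → g ≗ 𝟎 → Reversed D f g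
Reversed-𝟎 D f≗𝟎 g≗𝟎 = record
  { reversed = λ i j _ → ≡.trans (f≗𝟎 i) (≡.sym (g≗𝟎 j))
  ; boundˡ   = λ i _ → f≗𝟎 i
  ; boundʳ   = λ j _ → g≗𝟎 j }

Reversed-⊕ : ∀ {D f f′ g g′} → Reversed D f g → Reversed D f′ g′ → Reversed D (f ⊕ f′) (g ⊕ g′)
Reversed-⊕ R R′ = record
  { reversed = λ i j i+j → ≡.cong₂ ℕ._+_ (reversed R i j i+j) (reversed R′ i j i+j)
  ; boundˡ   = λ i D<i → ≡.cong₂ ℕ._+_ (boundˡ R i D<i) (boundˡ R′ i D<i)
  ; boundʳ   = λ j D<j → ≡.cong₂ ℕ._+_ (boundʳ R j D<j) (boundʳ R′ j D<j) }

Reversed-sym : ∀ {D f g} → Reversed D f g → Reversed D g f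
Reversed-sym R = record
  { reversed = λ i j i+j → ≡.sym (reversed R j i (≡.trans (ℕ.+-comm j i) i+j))
  ; boundˡ   = boundʳ R
  ; boundʳ   = boundˡ R }

Reversed-sh : ∀ {D f g} → Reversed D f g → Reversed (suc D) (sh f) g
Reversed-sh {D} {f} {g} R = record
  { reversed = λ { zero j ≡.refl → ≡.sym (boundʳ R j ℕ.≤-refl)
                 ; (suc i) j i+j → reversed R i j (ℕ.suc-injective i+j) }
  ; boundˡ   = λ { (suc i) (s≤s D<i) → boundˡ R i D<i }
  ; boundʳ   = λ j D<j → boundʳ R j (ℕ.<-trans ℕ.≤-refl D<j) }

Reversed-shⁿ : ∀ n {D f g} → Reversed D f g → Reversed (n ℕ.+ D) (shⁿ n f) g
Reversed-shⁿ zero    R = R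
Reversed-shⁿ (suc n) R = Reversed-sh (Reversed-shⁿ n R)

-- The largest exponent lo + m has codegree 0, so whatever lo is, the codegree side gains the bare
-- factor [m+1].
Reversed-layers : ∀ {n} lo m D {ms : List (Vec ℕ n)} {g} → Reversed D (count ms) g →
                  Reversed (lo ℕ.+ m ℕ.+ D) (count (layers lo (suc m) ms)) (box (suc m) g)
Reversed-layers lo zero D {ms} {g} R = Reversed-cong
  (λ d → ≡.sym (count-map (lo ℕ.+ 0) ms d))
  (λ d → ≡.sym (≡.trans (≡.cong (g d ℕ.+_) (sh-𝟎 d)) (ℕ.+-identityʳ (g d))))
  (Reversed-shⁿ (lo ℕ.+ 0) R)
Reversed-layers lo (suc m) D {ms} {g} R = Reversed-cong
  (λ d → ≡.sym (≡.trans (count-++ (layers lo (suc m) ms) _ d)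
                 (≡.cong (count (layers lo (suc m) ms) d ℕ.+_) (count-map (lo ℕ.+ suc m) ms d))))
  (λ d → ℕ.+-comm (sh (box (suc m) g) d) (g d))
  (Reversed-⊕
    (≡.subst (λ D′ → Reversed D′ (count (layers lo (suc m) ms)) (sh (box (suc m) g)))
      (≡.cong (ℕ._+ D) (≡.sym (ℕ.+-suc lo m)))
      (Reversed-sym (Reversed-sh (Reversed-sym (Reversed-layers lo m D R)))))
    (Reversed-shⁿ (lo ℕ.+ suc m) R))

-- For 1 ≤ k ≤ n, `top n 0 k` is the degree of the word k-1,...,1,0 followed by n - k copies of k -
-- 1.
top : ℕ → ℕ → ℕ → ℕ
top zero    r s       = 0
top (suc N) r zero    = ℕ.pred r ℕ.+ top N r 0
top (suc N) r (suc s) = s ℕ.+ top N (suc r) s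

-- The largest first exponent of the second kind, s + r, and the largest of the first kind, s, lead
-- to the same total degree; hence one `top` serves both blocks.
top-step : ∀ N r s → s < N → r ℕ.+ top N r (suc s) ≡ top N (suc r) s
top-step (suc N) r zero    s<N       = ≡.refl
top-step (suc N) r (suc s) (s≤s s<N) = ≡.trans
  (solve 3 (λ r s x → r :+ ((con 1 :+ s) :+ x) := s :+ ((con 1 :+ r) :+ x)) ≡.refl r s (top N (suc r) (suc s)))
  (≡.cong (s ℕ.+_) (top-step N (suc r) s s<N))
  where open +-*-Solver

layers-[] : ∀ {n} lo m → layers {n} lo m [] ≡ []
layers-[] lo zero    = ≡.refl
layers-[] lo (suc m) = ≡.cong (_++ []) (layers-[] lo m)

standardMonomials-[] : ∀ N r s → N < s → standardMonomials N r s ≡ []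
standardMonomials-[] zero    r (suc s) _         = ≡.refl
standardMonomials-[] (suc N) r (suc s) (s≤s N<s)
  rewrite standardMonomials-[] N (suc r) s N<s | standardMonomials-[] N r (suc s) (ℕ.m<n⇒m<1+n N<s)
        | layers-[] {N} 0 s | layers-[] {N} (suc s) r = ≡.refl

dual-𝟎 : ∀ N r s → N < s → dual N r s ≗ 𝟎
dual-𝟎 zero    r (suc s) _         d = ≡.refl
dual-𝟎 (suc N) r (suc s) (s≤s N<s) d = ≡.cong₂ ℕ._+_
  (≡.trans (box-cong (suc s) (dual-𝟎 N (suc r) s N<s) d) (box-𝟎 (suc s) d))
  (≡.trans (box-cong r (dual-𝟎 N r (suc s) (ℕ.m<n⇒m<1+n N<s)) d) (box-𝟎 r d))

count-dual : ∀ N r s → Reversed (top N r s) (count (standardMonomials N r s)) (dual N r s)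
count-dual zero    r zero    = record
  { reversed = λ { zero zero _ → ≡.refl }
  ; boundˡ   = λ { (suc i) _ → ≡.refl }
  ; boundʳ   = λ { (suc j) _ → ≡.refl } }
count-dual zero    r (suc s) = Reversed-𝟎 0 (λ _ → ≡.refl) (λ _ → ≡.refl)
count-dual (suc N) zero    zero = Reversed-𝟎 (top N 0 0) (λ _ → ≡.refl) (λ _ → ≡.refl)
count-dual (suc N) (suc r) zero = Reversed-layers 0 r (top N (suc r) 0) (count-dual N (suc r) 0)
count-dual (suc N) r (suc s) = Reversed-cong
  (λ d → ≡.sym (count-++ (layers 0 (suc s) (standardMonomials N (suc r) s)) _ d)) (λ _ → ≡.refl)
  (Reversed-⊕ (Reversed-layers 0 s (top N (suc r) s) (count-dual N (suc r) s)) (second r))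
  where
  second : ∀ r → Reversed (s ℕ.+ top N (suc r) s) (count (layers (suc s) r (standardMonomials N r (suc s))))
                          (box r (dual N r (suc s)))
  second zero    = Reversed-𝟎 _ (λ _ → ≡.refl) (λ _ → ≡.refl)
  second (suc r) with s ℕ.<? N
  ... | yes s<N = ≡.subst (λ D → Reversed D (count (layers (suc s) (suc r) (standardMonomials N (suc r) (suc s))))
                                           (box (suc r) (dual N (suc r) (suc s))))
    (≡.trans (solve 3 (λ s r x → (con 1 :+ s) :+ r :+ x := s :+ ((con 1 :+ r) :+ x)) ≡.refl s r (top N (suc r) (suc s)))
             (≡.cong (s ℕ.+_) (top-step N (suc r) s s<N)))
    (Reversed-layers (suc s) r (top N (suc r) (suc s)) (count-dual N (suc r) (suc s)))
    where open +-*-Solver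
  -- Here `top-step` does not apply, but N positions cannot use up s + 1 > N units, so both sides
  -- vanish.
  ... | no  s≮N = Reversed-𝟎 _
    (λ d → ≡.cong (λ ms → count ms d) (≡.trans
      (≡.cong (layers (suc s) (suc r)) (standardMonomials-[] N (suc r) (suc s) N<1+s)) (layers-[] (suc s) (suc r))))
    (λ d → ≡.trans (box-cong (suc r) (dual-𝟎 N (suc r) (suc s) N<1+s) d) (box-𝟎 (suc r) d))
    where N<1+s = s≤s (ℕ.≮⇒≥ s≮N)

-- The exact degree and `revq`

zeros-admissible : ∀ N r s → s ≤ N → 1 ≤ s ℕ.+ r → Admissible r s (V.replicate N 0)
zeros-admissible zero    r       zero    _         _   = ≡.refl
zeros-admissible (suc N) r       zero    _         1≤r = 1≤r , zeros-admissible N r 0 z≤n 1≤r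
zeros-admissible (suc N) r       (suc s) (s≤s s≤N) _   =
  inj₁ (s≤s z≤n , zeros-admissible N (suc r) s s≤N (≡.subst (1 ≤_) (≡.sym (ℕ.+-suc s r)) (s≤s z≤n)))

sum-zeros : ∀ N → V.sum (V.replicate N 0) ≡ 0
sum-zeros zero    = ≡.refl
sum-zeros (suc N) = sum-zeros N

-- `revq` reverses about the true degree. That this is `top` requires a nonzero coefficient there,
-- which by reversal counts the standard monomials of degree 0; the monomial 1 is one.
count₀-positive : ∀ N r s → s ≤ N → 1 ≤ s ℕ.+ r → 0 < count (standardMonomials N r s) 0
count₀-positive N r s s≤N 1≤s+r = ∈⇒0<length (∈-filter⁺ (λ α → V.sum α ℕ.≟ 0)
  (standardMonomials-complete r s (zeros-admissible N r s s≤N 1≤s+r)) (sum-zeros N))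
  where
  ∈⇒0<length : ∀ {A : Set} {x : A} {xs} → x ∈ xs → 0 < L.length xs
  ∈⇒0<length (here _)  = s≤s z≤n
  ∈⇒0<length (there _) = s≤s z≤n

coeffq-beyond : ∀ f i → L.length f ≤ i → coeffq f i ≡ 0
coeffq-beyond []      i       _         = ≡.refl
coeffq-beyond (a ∷ f) (suc i) (s≤s len) = coeffq-beyond f i len

coeffq-∷ʳ-< : ∀ f a i → i < L.length f → coeffq (f ++ a ∷ []) i ≡ coeffq f i
coeffq-∷ʳ-< (b ∷ f) a zero    _         = ≡.refl
coeffq-∷ʳ-< (b ∷ f) a (suc i) (s≤s i<l) = coeffq-∷ʳ-< f a i i<l

coeffq-∷ʳ-length : ∀ f a → coeffq (f ++ a ∷ []) (L.length f) ≡ a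
coeffq-∷ʳ-length []      a = ≡.refl
coeffq-∷ʳ-length (b ∷ f) a = coeffq-∷ʳ-length f a

dropLeadingZeros-zeros : ∀ f ys → coeffq f ≗ 𝟎 → dropLeadingZeros (L.reverse f ++ ys) ≡ dropLeadingZeros ys
dropLeadingZeros-zeros []      ys f≗𝟎 = ≡.refl
dropLeadingZeros-zeros (a ∷ f) ys f≗𝟎 = begin
  dropLeadingZeros (L.reverse (a ∷ f) ++ ys)
    ≡⟨ ≡.cong (λ l → dropLeadingZeros (l ++ ys)) (L.unfold-reverse a f) ⟩
  dropLeadingZeros ((L.reverse f ++ a ∷ []) ++ ys)
    ≡⟨ ≡.cong dropLeadingZeros (L.++-assoc (L.reverse f) (a ∷ []) ys) ⟩
  dropLeadingZeros (L.reverse f ++ a ∷ ys)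
    ≡⟨ dropLeadingZeros-zeros f (a ∷ ys) (λ d → f≗𝟎 (suc d)) ⟩
  dropLeadingZeros (a ∷ ys)
    ≡⟨ ≡.cong (λ a → dropLeadingZeros (a ∷ ys)) (f≗𝟎 0) ⟩
  dropLeadingZeros ys ∎
  where open ≡-Reasoning

-- The length hypothesis says that something survives the stripping; otherwise the appended entry
-- could itself be stripped.
dropLeadingZeros-∷ʳ : ∀ ys a {l} → L.length (dropLeadingZeros ys) ≡ suc l →
                      dropLeadingZeros (ys ++ a ∷ []) ≡ dropLeadingZeros ys ++ a ∷ []
dropLeadingZeros-∷ʳ (zero ∷ ys)  a len = dropLeadingZeros-∷ʳ ys a len
dropLeadingZeros-∷ʳ (suc y ∷ ys) a len = ≡.refl

dropLeadingZeros-singleton : ∀ {a} → 0 < a → dropLeadingZeros (a ∷ []) ≡ a ∷ []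
dropLeadingZeros-singleton (s≤s _) = ≡.refl

record TopDegree (f : QPol) (D : ℕ) : Set where
  field
    leading : 0 < coeffq f D
    bound   : ∀ i → D < i → coeffq f i ≡ 0

open TopDegree

revq-∷ : ∀ a f D → L.length (revq f) ≡ suc D → revq (a ∷ f) ≡ revq f ++ a ∷ []
revq-∷ a f D len = ≡.trans (≡.cong dropLeadingZeros (L.unfold-reverse a f)) (dropLeadingZeros-∷ʳ (L.reverse f) a len)

length-revq : ∀ f D → TopDegree f D → L.length (revq f) ≡ suc D
length-revq []      D       T with leading T
... | ()
length-revq (a ∷ f) zero    T = ≡.cong L.length (≡.trans (≡.cong dropLeadingZeros (L.unfold-reverse a f))
  (≡.trans (dropLeadingZeros-zeros f (a ∷ []) (λ d → bound T (suc d) (s≤s z≤n))) (dropLeadingZeros-singleton (leading T))))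
length-revq (a ∷ f) (suc D) T = ≡.trans (≡.cong L.length (revq-∷ a f D ih))
  (≡.trans (L.length-++ (revq f)) (≡.trans (ℕ.+-comm _ 1) (≡.cong suc ih)))
  where ih = length-revq f D (record { leading = leading T ; bound = λ i D<i → bound T (suc i) (s≤s D<i) })

revq-reversed : ∀ f D → TopDegree f D → Reversed D (coeffq (revq f)) (coeffq f)
revq-reversed f D T = record
  { reversed = go f D T
  ; boundˡ   = λ i D<i → coeffq-beyond (revq f) i (≡.subst (_≤ i) (≡.sym (length-revq f D T)) D<i)
  ; boundʳ   = bound T }
  where
  go : ∀ f D → TopDegree f D → ∀ i j → i ℕ.+ j ≡ D → coeffq (revq f) i ≡ coeffq f j
  go []      D       T i    j    _ with leading T
  ... | ()
  go (a ∷ f) zero    T zero zero _ = ≡.cong (λ l → coeffq l 0) (≡.trans (≡.cong dropLeadingZeros (L.unfold-reverse a f))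
    (≡.trans (dropLeadingZeros-zeros f (a ∷ []) (λ d → bound T (suc d) (s≤s z≤n))) (dropLeadingZeros-singleton (leading T))))
  go (a ∷ f) (suc D) T i    j    i+j = ≡.trans (≡.cong (λ l → coeffq l i) (revq-∷ a f D len)) (last j i+j)
    where
    T′ : TopDegree f D
    T′ = record { leading = leading T ; bound = λ i D<i → bound T (suc i) (s≤s D<i) }
    len = length-revq f D T′
    last : ∀ j → i ℕ.+ j ≡ suc D → coeffq (revq f ++ a ∷ []) i ≡ coeffq (a ∷ f) j
    last zero    i+0 = ≡.trans
      (≡.cong (coeffq (revq f ++ a ∷ [])) (≡.trans (≡.sym (ℕ.+-identityʳ i)) (≡.trans i+0 (≡.sym len))))
      (coeffq-∷ʳ-length (revq f) a)
    last (suc j) i+j = ≡.trans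
      (coeffq-∷ʳ-< (revq f) a i (≡.subst (i <_) (≡.sym len) (s≤s (≡.subst (i ≤_) i+j≡D (ℕ.m≤m+n i j)))))
      (go f D T′ i j i+j≡D)
      where i+j≡D = ℕ.suc-injective (≡.trans (≡.sym (ℕ.+-suc i j)) i+j)

Reversed-unique : ∀ {D f f′ g} → Reversed D f g → Reversed D f′ g → f ≗ f′
Reversed-unique {D} R R′ i with i ℕ.≤? D
... | yes i≤D = ≡.trans (reversed R i (D ℕ.∸ i) (ℕ.m+[n∸m]≡n i≤D)) (≡.sym (reversed R′ i (D ℕ.∸ i) (ℕ.m+[n∸m]≡n i≤D)))
... | no  i≰D = ≡.trans (boundˡ R i (ℕ.≰⇒> i≰D)) (≡.sym (boundˡ R′ i (ℕ.≰⇒> i≰D)))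

count-revq : ∀ n k → 1 ≤ k → k ≤ n → count (standardMonomials n 0 k) ≗ coeffq (revq (qFact k *q qStir n k))
count-revq n k 1≤k k≤n = Reversed-unique R (revq-reversed (qFact k *q qStir n k) (top n 0 k) topDegree)
  where
  R : Reversed (top n 0 k) (count (standardMonomials n 0 k)) (coeffq (qFact k *q qStir n k))
  R = Reversed-cong (λ _ → ≡.refl) (λ d → ≡.sym (qOrderedStir-dual n k d)) (count-dual n 0 k)
  topDegree : TopDegree (qFact k *q qStir n k) (top n 0 k)
  topDegree = record
    { leading = ≡.subst (0 <_) (reversed R 0 (top n 0 k) ≡.refl)
        (count₀-positive n 0 k k≤n (≡.subst (1 ≤_) (≡.sym (ℕ.+-identityʳ k)) 1≤k))
    ; bound   = boundʳ R }

-- The Hilbert series and the dimension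

open import Data.Nat using (_*_)

theorem3p8 : ∀ {c ℓ : Level} (F : Field c ℓ) (n k : ℕ) → 1 ≤ k → k ≤ n →
    ((d : ℕ) → Poly.dimGradedS≡ F n k d (coeffq (revq (qFact k *q qStir n k)) d))
    × Poly.dimS≡ F n k ((k !) * stir n k)
theorem3p8 F n (suc κ) 1≤k k≤n =
  (λ d → ≡.subst (Poly.dimGradedS≡ F n (suc κ) d) (count-revq n (suc κ) 1≤k k≤n d)
    (dimGradedS n κ d (L.filter (degree? d) bs) k≤n
      (All.zip (All.filter⁺ (degree? d) sound , All.all-filter (degree? d) bs))
      (AllPairs.filter⁺ (degree? d) sorted)
      (λ adm degα → ∈-filter⁺ (degree? d) (complete adm) degα))) ,
  ≡.subst (Poly.dimS≡ F n (suc κ)) (size-stir n (suc κ)) (dimS n κ bs k≤n sound sorted complete)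
  where
  open Dimension F
  bs = standardMonomials n 0 (suc κ)
  sound = standardMonomials-sound n 0 (suc κ)
  sorted = standardMonomials-sorted n 0 (suc κ)
  complete : ∀ {α : Vec ℕ n} → Admissible 0 (suc κ) α → α ∈ bs
  complete = standardMonomials-complete 0 (suc κ)
  degree? : ∀ d (α : Vec ℕ n) → _
  degree? d α = V.sum α ℕ.≟ d
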